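{- Let $C\ge 2$ and $d\ge 1$ be integers and let $\rho=\sum_{i=0}^d C^i=\frac{C^{d+1}-1}{C-1}$. Consider an instance of \textsc{L-Sided Pricing} with $\mu_u\le C$ for every $u\in L$. Let $p^*$ be an optimal pricing and let $p$ be a pricing that is locally optimal, i.e. $\mathrm{val}(p')\le\mathrm{val}(p)$ for every pricing $p'$ with $\mathrm{HW}(p,p')\le\rho$. Then \[\mathrm{val}(p)\ge\frac{C-C^{ -d}}{2C-1-C^{ -d}}\cdot\mathrm{val}(p^*).\]
   Context: An instance of \textsc{L-Sided Pricing} consists of a finite bipartite graph $G=(L\cup R,E)$ (parallel edges allowed, no loops; each edge joins $L$ and $R$), a capacity $\mu_w\in\mathbb Z_{\ge 0}\cup\{\infty\}$ for every vertex $w$, and a budget $b_e\ge 0$ for every edge $e$. For $u\in L$ let $P_u=\{b_e: e\in E\text{ incident to }u\}$. A pricing is a function $p$ on $L$ with $p(u)\in P_u$ for every $u\in L$, extended by $p(v)=0$ for $v\in R$. For a pricing $p$, $\mathrm{val}(p)$ is the maximum of $\sum_{e=uv\in F}(p(u)+p(v))$ over all $F\subseteq E$ such that $p(u)+p(v)\le b_e$ for every $e=uv\in F$ and every vertex $w$ is incident to at most $\mu_w$ edges of $F$. An optimal pricing is a pricing maximizing $\mathrm{val}$. For pricings $p,p'$, $\mathrm{HW}(p,p')=|\{u\in L: p(u)\ne p'(u)\}|$.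
   Formalization: The budgets b_e are taken to be nonnegative rational numbers rather than nonnegative real numbers (so prices and values are rational as well). -}

module Defs where

open import Data.Nat as ℕ using (ℕ; zero; suc; _∸_; _^_)
open import Data.Bool using (Bool; true; false; _∧_; not; if_then_else_)
open import Data.Fin using (Fin)
open import Data.Fin.Properties using () renaming (_≟_ to _≟F_)
open import Data.Vec using (Vec; []; _∷_; lookup)
open import Data.List using (List; []; _∷_; map; filter; length; foldr; _++_; allFin)
open import Data.Product using (Σ; _×_; _,_; proj₁; proj₂)
open import Data.Empty using (⊥)
open import Relation.Nullary using (does)
open import Relation.Binary.PropositionalEquality using (_≡_)
open import Data.Rational as ℚ using (ℚ; 0ℚ; _≤_; _≤ᵇ_; _⊔_)
open import Data.Rational.Properties using () renaming (_≟_ to _≟ℚ_)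
open import Data.Integer using (+_)

data Cap : Set where
  fin : ℕ → Cap
  ∞   : Cap

capOK : ℕ → Cap → Bool
capOK k (fin c) = k ℕ.≤ᵇ c
capOK k ∞       = true

CapLe : Cap → ℕ → Set
CapLe (fin c) C = c ℕ.≤ C
CapLe ∞       C = ⊥

ℕtoℚ : ℕ → ℚ
ℕtoℚ n = + n ℚ./ 1

-- An instance of L-Sided Pricing: L = Fin nL, R = Fin nR, edges indexed by Fin m
-- (parallel edges allowed), each edge e joins left e ∈ L and right e ∈ R.
record Instance : Set where
  field
    nL nR m : ℕ
    left    : Fin m → Fin nL
    right   : Fin m → Fin nR
    μL      : Fin nL → Cap
    μR      : Fin nR → Cap
    budget  : Fin m → ℚ
    budget≥0 : (e : Fin m) → 0ℚ ≤ budget e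

module _ (I : Instance) where
  open Instance I

  -- a pricing: p(u) ∈ P_u = { b_e : e incident to u } for each u ∈ L
  -- (p(v) = 0 for v ∈ R is implicit below)
  IsPricing : (Fin nL → ℚ) → Set
  IsPricing p = (u : Fin nL) → Σ (Fin m) λ e → (left e ≡ u) × (p u ≡ budget e)

  Pricing : Set
  Pricing = Σ (Fin nL → ℚ) IsPricing

  EdgeSet : Set
  EdgeSet = Vec Bool m

  edges : EdgeSet → List (Fin m)
  edges F = filter (λ e → lookup F e Data.Bool.≟ true) (allFin m)

  degL : EdgeSet → Fin nL → ℕ
  degL F u = length (filter (λ e → left e ≟F u) (edges F))

  degR : EdgeSet → Fin nR → ℕ
  degR F v = length (filter (λ e → right e ≟F v) (edges F))

  allB : {n : ℕ} → (Fin n → Bool) → Bool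
  allB {n} f = foldr (λ i b → f i ∧ b) true (allFin n)

  -- F is feasible for p: p(u)+p(v) = p(u) ≤ b_e on F, and capacities respected
  feasible : (Fin nL → ℚ) → EdgeSet → Bool
  feasible p F =
    foldr (λ e b → (p (left e) ≤ᵇ budget e) ∧ b) true (edges F)
    ∧ allB (λ u → capOK (degL F u) (μL u))
    ∧ allB (λ v → capOK (degR F v) (μR v))

  -- revenue Σ_{e=uv ∈ F} (p(u) + p(v)) with p(v) = 0
  revenue : (Fin nL → ℚ) → EdgeSet → ℚ
  revenue p F = foldr (λ e s → (p (left e) ℚ.+ 0ℚ) ℚ.+ s) 0ℚ (edges F)

  allSubsets : (n : ℕ) → List (Vec Bool n)
  allSubsets zero    = [] ∷ []
  allSubsets (suc n) = map (true ∷_) (allSubsets n) ++ map (false ∷_) (allSubsets n)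

  -- val(p) = max revenue over feasible F (∅ is always feasible with revenue 0)
  val : (Fin nL → ℚ) → ℚ
  val p = foldr (λ F s → (if feasible p F then revenue p F else 0ℚ) ⊔ s) 0ℚ (allSubsets m)

  HW : (Fin nL → ℚ) → (Fin nL → ℚ) → ℕ
  HW p q = length (filter (λ u → Relation.Nullary.¬? (p u ≟ℚ q u)) (allFin nL))

  Optimal : Pricing → Set
  Optimal p = (q : Pricing) → val (proj₁ q) ≤ val (proj₁ p)

  LocallyOptimal : ℕ → Pricing → Set
  LocallyOptimal r p = (q : Pricing) → HW (proj₁ p) (proj₁ q) ℕ.≤ r → val (proj₁ q) ≤ val (proj₁ p)

geomSum : ℕ → ℕ → ℕ
geomSum C zero    = 1
geomSum C (suc d) = geomSum C d ℕ.+ C ^ suc d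

{-# OPTIONS --safe #-}
-- Let M and N be optimal edge sets for p and p*, and pair off, at every right vertex, as many
-- edges of N as possible with edges of M. Switching a set S ⊆ L from p to p* keeps the edge set
-- feasible if the M-edges at S and the partners of the inserted N-edges are dropped. So if
-- g u = w(M_u) − w*(N_u), local optimality says that g(S) plus the weight of the partner edges
-- cut by S is nonnegative as soon as |S| ≤ ρ.
--
-- The partner relation is a digraph on L with in- and outdegrees at most C. Let T k u be the sum
-- of g over the nodes of the tree of walks from u of length ≤ k, plus the weight of the arcs that
-- leave its leaves. Slicing the multiplicities of this tree into level sets, each of size ≤ ρ,
-- gives T k u ≥ 0 for k ≤ d. As T (k+1) u = g u + Σ T k y over the arcs u → y, indegree ≤ C
-- yields Σ T (k+1) ≤ Σ g + C Σ T k, hence 0 ≤ Σ T d ≤ ρ Σ g + C^d w(M), which is the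
-- claimed ratio 1 + C^d/ρ.
module Submission where

open import Defs
open import Data.Nat using (ℕ; _≤_; _^_; _∸_; _*_)
open import Data.Product using (proj₁)
open import Data.Fin using (Fin)
open import Data.Rational using () renaming (_≤_ to _≤ℚ_; _*_ to _*ℚ_)
open import Algebra.Core using (Op₂)
open import Algebra.Structures using (IsCommutativeSemiring; module IsCommutativeRing)
open import Data.Bool as Bool using (Bool; true; false; _∧_; not; if_then_else_)
open import Data.Bool.ListAction using (any)
open import Data.Bool.Properties using (T-≡)
open import Data.Fin using (zero; suc)
open import Data.Fin.Properties using () renaming (_≟_ to _≟F_)
import Data.Integer as ℤ
import Data.Integer.Properties as ℤ
open import Data.List using (List; []; _∷_; filter; length; foldr; _++_; allFin; tabulate; concatMap; zip)
open import Data.List.Membership.Propositional using (_∈_; lose)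
open import Data.List.Membership.Propositional.Properties using (∈-filter⁺; ∈-filter⁻; ∈-allFin; ∈-concatMap⁺; ∈-++⁺ˡ; ∈-++⁺ʳ; ∈-map⁺)
open import Data.List.Relation.Unary.Any using (here; there)
open import Data.Nat as ℕ using (zero; suc; z≤n; s≤s)
import Data.Nat
import Data.Nat.Properties as ℕ
open import Data.Nat.Tactic.RingSolver using (solve-∀)
open import Data.Product using (Σ; _×_; _,_; proj₂)
open import Data.Rational as ℚ using (ℚ; 0ℚ; 1ℚ)
import Data.Rational.Properties as ℚ
open import Data.Rational.Solver using (module +-*-Solver)
open import Data.Rational.Unnormalised as ℚᵘ using (mkℚᵘ; *≡*)
import Data.Rational.Unnormalised.Properties as ℚᵘ
open import Data.Sum using (inj₁; inj₂)
open import Data.Vec as Vec using (Vec; lookup)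
open import Data.Vec.Properties using (lookup∘tabulate; lookup-replicate)
open import Function using (_∘_; id)
open import Function.Bundles using (Equivalence)
open import Level using (0ℓ)
open import Relation.Binary using (Rel; IsPreorder)
open import Relation.Binary.PropositionalEquality
open import Relation.Nullary using (Dec; does; yes; no; ¬?; contradiction)

-- Boolean equality, fibres, matchings and spliced edge sets.

_==_ : ∀ {n} → Fin n → Fin n → Bool
i == j = does (i ≟F j)

==-sym : ∀ {n} (i j : Fin n) → (i == j) ≡ (j == i)
==-sym zero zero = refl
==-sym zero (suc j) = refl
==-sym (suc i) zero = refl
==-sym (suc i) (suc j) = ==-sym i j

==-refl : ∀ {n} (i : Fin n) → (i == i) ≡ true
==-refl zero = refl
==-refl (suc i) = ==-refl i

==⇒≡ : ∀ {n} (i j : Fin n) → (i == j) ≡ true → i ≡ j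
==⇒≡ i j eq with i ≟F j
... | yes i≡j = i≡j

fibre : ∀ {A : Set} {n} → (A → Fin n) → Fin n → List A → List A
fibre t v = filter (λ x → t x ≟F v)

-- Within every fibre of t as many elements of xs as possible are paired off with elements of ys.
matching : ∀ {A : Set} {n} → (A → Fin n) → List A → List A → List (A × A)
matching {n = n} t xs ys = concatMap (λ v → zip (fibre t v xs) (fibre t v ys)) (allFin n)

-- For each edge, `s` alone decides whether `N` or `M` is consulted. So an edge lying in both sets
-- is counted at most once, and sums over the result split into an `N`-part and an `M`-part.
splice : ∀ {m} → (s r : Fin m → Bool) → (N M : Vec Bool m) → Vec Bool m
splice s r N M = Vec.tabulate (λ e → if s e then lookup N e else lookup M e ∧ not (r e))

-- Sums over lists, generic so as to serve counts in ℕ and weights in ℚ.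

module ListSum {R : Set} {_+_ _*_ : Op₂ R} {0# 1# : R}
  (isCommutativeSemiring : IsCommutativeSemiring _≡_ _+_ _*_ 0# 1#)
  {_≤_ : Rel R 0ℓ} (isPreorder : IsPreorder _≡_ _≤_)
  (+-mono-≤ : ∀ {x y u v} → x ≤ y → u ≤ v → (x + u) ≤ (y + v)) where

  open IsCommutativeSemiring isCommutativeSemiring
    using (+-assoc; +-comm; +-identityˡ; +-identityʳ; distribˡ; distribʳ; zeroˡ; zeroʳ)
  open IsPreorder isPreorder using () renaming (reflexive to ≤-reflexive)

  private variable
    A B : Set

  when : Bool → R → R
  when true  x = x
  when false x = 0#

  ∑ : List A → (A → R) → R
  ∑ xs f = foldr (λ x s → f x + s) 0# xs

  when-0 : ∀ b → when b 0# ≡ 0#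
  when-0 true  = refl
  when-0 false = refl

  when-+ : ∀ b x y → when b (x + y) ≡ when b x + when b y
  when-+ true  x y = refl
  when-+ false x y = sym (+-identityˡ 0#)

  when-* : ∀ b x y → when b (x * y) ≡ when b x * y
  when-* true  x y = refl
  when-* false x y = sym (zeroˡ y)

  when-comm : ∀ a b x → when a (when b x) ≡ when b (when a x)
  when-comm true  b x = refl
  when-comm false b x = sym (when-0 b)

  when-∧ : ∀ a b x → when (a ∧ b) x ≡ when a (when b x)
  when-∧ true  b x = refl
  when-∧ false b x = refl

  when-mono : ∀ b {x y} → x ≤ y → when b x ≤ when b y
  when-mono true  x≤y = x≤y
  when-mono false x≤y = ≤-reflexive refl

  0≤when : ∀ b {x} → 0# ≤ x → 0# ≤ when b x
  0≤when true  0≤x = 0≤x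
  0≤when false 0≤x = ≤-reflexive refl

  when≤ : ∀ b {x} → 0# ≤ x → when b x ≤ x
  when≤ true  0≤x = ≤-reflexive refl
  when≤ false 0≤x = 0≤x

  ∑-cong : ∀ (xs : List A) {f g : A → R} → (∀ x → f x ≡ g x) → ∑ xs f ≡ ∑ xs g
  ∑-cong []       eq = refl
  ∑-cong (x ∷ xs) eq = cong₂ _+_ (eq x) (∑-cong xs eq)

  ∑-mono : ∀ (xs : List A) {f g : A → R} → (∀ x → f x ≤ g x) → ∑ xs f ≤ ∑ xs g
  ∑-mono []       le = ≤-reflexive refl
  ∑-mono (x ∷ xs) le = +-mono-≤ (le x) (∑-mono xs le)

  ∑-0 : ∀ (xs : List A) → ∑ xs (λ _ → 0#) ≡ 0#
  ∑-0 []       = refl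
  ∑-0 (x ∷ xs) = trans (+-identityˡ _) (∑-0 xs)

  0≤∑ : ∀ (xs : List A) {f : A → R} → (∀ x → 0# ≤ f x) → 0# ≤ ∑ xs f
  0≤∑ xs {f} 0≤f = subst (_≤ ∑ xs f) (∑-0 xs) (∑-mono xs 0≤f)

  private
    interchange : ∀ a b c d → (a + b) + (c + d) ≡ (a + c) + (b + d)
    interchange a b c d = begin
      (a + b) + (c + d) ≡⟨ +-assoc a b (c + d) ⟩
      a + (b + (c + d)) ≡⟨ cong (a +_) (sym (+-assoc b c d)) ⟩
      a + ((b + c) + d) ≡⟨ cong (λ z → a + (z + d)) (+-comm b c) ⟩
      a + ((c + b) + d) ≡⟨ cong (a +_) (+-assoc c b d) ⟩
      a + (c + (b + d)) ≡⟨ sym (+-assoc a c (b + d)) ⟩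
      (a + c) + (b + d) ∎
      where open ≡-Reasoning

  ∑-+ : ∀ (xs : List A) (f g : A → R) → ∑ xs (λ x → f x + g x) ≡ ∑ xs f + ∑ xs g
  ∑-+ []       f g = sym (+-identityˡ 0#)
  ∑-+ (x ∷ xs) f g = trans (cong ((f x + g x) +_) (∑-+ xs f g)) (interchange _ _ _ _)

  ∑-* : ∀ (xs : List A) (f : A → R) c → ∑ xs (λ x → f x * c) ≡ ∑ xs f * c
  ∑-* []       f c = sym (zeroˡ c)
  ∑-* (x ∷ xs) f c = trans (cong ((f x * c) +_) (∑-* xs f c)) (sym (distribʳ c _ _))

  ∑-*ˡ : ∀ (xs : List A) c (f : A → R) → ∑ xs (λ x → c * f x) ≡ c * ∑ xs f
  ∑-*ˡ []       c f = sym (zeroʳ c)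
  ∑-*ˡ (x ∷ xs) c f = trans (cong ((c * f x) +_) (∑-*ˡ xs c f)) (sym (distribˡ c _ _))

  ∑-when : ∀ (xs : List A) b (f : A → R) → ∑ xs (λ x → when b (f x)) ≡ when b (∑ xs f)
  ∑-when xs true  f = refl
  ∑-when xs false f = ∑-0 xs

  ∑-swap : ∀ (xs : List A) (ys : List B) (f : A → B → R) →
           ∑ xs (λ x → ∑ ys (f x)) ≡ ∑ ys (λ y → ∑ xs (λ x → f x y))
  ∑-swap []       ys f = sym (∑-0 ys)
  ∑-swap (x ∷ xs) ys f =
    trans (cong (∑ ys (f x) +_) (∑-swap xs ys f)) (sym (∑-+ ys (f x) _))

  ∑-++ : ∀ (xs ys : List A) (f : A → R) → ∑ (xs ++ ys) f ≡ ∑ xs f + ∑ ys f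
  ∑-++ []       ys f = sym (+-identityˡ _)
  ∑-++ (x ∷ xs) ys f = trans (cong (f x +_) (∑-++ xs ys f)) (sym (+-assoc _ _ _))

  ∑-concatMap : ∀ (xs : List A) (h : A → List B) (f : B → R) →
                ∑ (concatMap h xs) f ≡ ∑ xs (λ x → ∑ (h x) f)
  ∑-concatMap []       h f = refl
  ∑-concatMap (x ∷ xs) h f = trans (∑-++ (h x) _ f) (cong (∑ (h x) f +_) (∑-concatMap xs h f))

  ∑-tabulate : ∀ {n} (h : Fin n → A) (f : A → R) → ∑ (tabulate h) f ≡ ∑ (allFin n) (f ∘ h)
  ∑-tabulate {n = zero}  h f = refl
  ∑-tabulate {n = suc n} h f = cong (f (h zero) +_)
    (trans (∑-tabulate (h ∘ suc) f) (sym (∑-tabulate suc (f ∘ h))))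

  ∑-pick : ∀ {n} (i : Fin n) (f : Fin n → R) → ∑ (allFin n) (λ j → when (i == j) (f j)) ≡ f i
  ∑-pick {suc n} zero f = trans
    (cong (f zero +_) (trans (∑-tabulate {n = n} suc (λ j → when (zero == j) (f j))) (∑-0 (allFin n))))
    (+-identityʳ _)
  ∑-pick {suc n} (suc i) f = trans (+-identityˡ _)
    (trans (∑-tabulate {n = n} suc (λ j → when (suc i == j) (f j))) (∑-pick i (f ∘ suc)))

  ∑-fibre : ∀ {n} (xs : List A) (t : A → Fin n) (f : A → R) →
            ∑ (allFin n) (λ v → ∑ xs (λ x → when (t x == v) (f x))) ≡ ∑ xs f
  ∑-fibre {n = n} xs t f = trans (∑-swap (allFin n) xs _) (∑-cong xs (λ x → ∑-pick (t x) (λ _ → f x)))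

  ∑-fibre-when : ∀ {n} (xs : List A) (t : A → Fin n) (S : Fin n → Bool) (f : A → R) →
    ∑ (allFin n) (λ v → when (S v) (∑ xs (λ x → when (t x == v) (f x)))) ≡ ∑ xs (λ x → when (S (t x)) (f x))
  ∑-fibre-when {n = n} xs t S f = trans
    (∑-cong (allFin n) (λ v → sym (∑-when xs (S v) _)))
    (trans (∑-swap (allFin n) xs _) (∑-cong xs (λ x → trans
      (∑-cong (allFin n) (λ v → when-comm (S v) (t x == v) (f x)))
      (∑-pick (t x) (λ v → when (S v) (f x))))))

  ∑-filter : ∀ {P : A → Set} (P? : ∀ x → Dec (P x)) (xs : List A) (f : A → R) →
             ∑ (filter P? xs) f ≡ ∑ xs (λ x → when (does (P? x)) (f x))
  ∑-filter P? []       f = refl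
  ∑-filter P? (x ∷ xs) f with does (P? x)
  ... | true  = cong (f x +_) (∑-filter P? xs f)
  ... | false = trans (∑-filter P? xs f) (sym (+-identityˡ _))

  -- Union bound: if several entries satisfy `r`, the right side counts `y` several times, which
  -- only helps as `y` is nonnegative.
  when-any≤ : ∀ (r : A → Bool) xs {y} → 0# ≤ y → when (any r xs) y ≤ ∑ xs (λ x → when (r x) y)
  when-any≤ r []       0≤y = ≤-reflexive refl
  when-any≤ r (x ∷ xs) {y} 0≤y with r x
  ... | true  = subst (_≤ (y + ∑ xs (λ x → when (r x) y))) (+-identityʳ y)
                  (+-mono-≤ (≤-reflexive refl) (0≤∑ xs (λ x → 0≤when (r x) 0≤y)))
  ... | false = subst (when (any r xs) y ≤_) (sym (+-identityˡ _)) (when-any≤ r xs 0≤y)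

  ∑-zip₁ : ∀ (xs : List A) (ys : List B) {f : A → R} → (∀ x → 0# ≤ f x) → ∑ (zip xs ys) (f ∘ proj₁) ≤ ∑ xs f
  ∑-zip₁ []       ys       0≤f = ≤-reflexive refl
  ∑-zip₁ (x ∷ xs) []       0≤f = 0≤∑ (x ∷ xs) 0≤f
  ∑-zip₁ (x ∷ xs) (y ∷ ys) 0≤f = +-mono-≤ (≤-reflexive refl) (∑-zip₁ xs ys 0≤f)

  ∑-zip₂ : ∀ (xs : List A) (ys : List B) {f : B → R} → (∀ y → 0# ≤ f y) → ∑ (zip xs ys) (f ∘ proj₂) ≤ ∑ ys f
  ∑-zip₂ []       ys       0≤f = 0≤∑ ys 0≤f
  ∑-zip₂ (x ∷ xs) []       0≤f = ≤-reflexive refl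
  ∑-zip₂ (x ∷ xs) (y ∷ ys) 0≤f = +-mono-≤ (≤-reflexive refl) (∑-zip₂ xs ys 0≤f)

  -- The fibres of `t` partition `xs`, and inside a fibre `zip` uses each entry at most once; the
  -- unpaired entries contribute nonnegative terms.
  ∑-matching₁ : ∀ {n} (t : A → Fin n) (xs ys : List A) {f : A → R} → (∀ x → 0# ≤ f x) →
                ∑ (matching t xs ys) (f ∘ proj₁) ≤ ∑ xs f
  ∑-matching₁ {n = n} t xs ys {f} 0≤f = subst₂ _≤_
    (sym (∑-concatMap (allFin n) (λ v → zip (fibre t v xs) (fibre t v ys)) (f ∘ proj₁)))
    (trans (∑-cong (allFin n) (λ v → ∑-filter (λ x → t x ≟F v) xs f)) (∑-fibre xs t f))
    (∑-mono (allFin n) (λ v → ∑-zip₁ (fibre t v xs) (fibre t v ys) 0≤f))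

  ∑-matching₂ : ∀ {n} (t : A → Fin n) (xs ys : List A) {f : A → R} → (∀ x → 0# ≤ f x) →
                ∑ (matching t xs ys) (f ∘ proj₂) ≤ ∑ ys f
  ∑-matching₂ {n = n} t xs ys {f} 0≤f = subst₂ _≤_
    (sym (∑-concatMap (allFin n) (λ v → zip (fibre t v xs) (fibre t v ys)) (f ∘ proj₂)))
    (trans (∑-cong (allFin n) (λ v → ∑-filter (λ x → t x ≟F v) ys f)) (∑-fibre ys t f))
    (∑-mono (allFin n) (λ v → ∑-zip₂ (fibre t v xs) (fibre t v ys) 0≤f))

  module _ (I : Instance) where
    open Instance I using (m)

    ∑-edges : ∀ (F : EdgeSet I) (f : Fin m → R) →
              ∑ (edges I F) f ≡ ∑ (allFin m) (λ e → when (lookup F e) (f e))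
    ∑-edges F f = trans (∑-filter (λ e → lookup F e Bool.≟ true) (allFin m) f)
      (∑-cong (allFin m) (λ e → cong (λ b → when b (f e)) (does-≟true (lookup F e))))
      where
      does-≟true : ∀ b → does (b Bool.≟ true) ≡ b
      does-≟true true  = refl
      does-≟true false = refl

    ∑-splice : ∀ (s r : Fin m → Bool) (N M : EdgeSet I) (f : Fin m → R) →
      ∑ (edges I (splice s r N M)) f
      ≡ ∑ (edges I N) (λ e → when (s e) (f e)) + ∑ (edges I M) (λ e → when (not (s e) ∧ not (r e)) (f e))
    ∑-splice s r N M f = begin
      ∑ (edges I (splice s r N M)) f
        ≡⟨ ∑-edges (splice s r N M) f ⟩
      ∑ (allFin m) (λ e → when (lookup (splice s r N M) e) (f e))
        ≡⟨ ∑-cong (allFin m) (λ e → trans (cong (λ b → when b (f e)) (lookup∘tabulate _ e))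
             (cases (s e) (r e) (lookup N e) (lookup M e) (f e))) ⟩
      ∑ (allFin m) (λ e → when (lookup N e) (when (s e) (f e)) + when (lookup M e) (when (not (s e) ∧ not (r e)) (f e)))
        ≡⟨ ∑-+ (allFin m) _ _ ⟩
      ∑ (allFin m) (λ e → when (lookup N e) (when (s e) (f e)))
        + ∑ (allFin m) (λ e → when (lookup M e) (when (not (s e) ∧ not (r e)) (f e)))
        ≡⟨ sym (cong₂ _+_ (∑-edges N _) (∑-edges M _)) ⟩
      ∑ (edges I N) (λ e → when (s e) (f e)) + ∑ (edges I M) (λ e → when (not (s e) ∧ not (r e)) (f e)) ∎
      where
      open ≡-Reasoning
      cases : ∀ s r n k x → when (if s then n else k ∧ not r) x ≡ when n (when s x) + when k (when (not s ∧ not r) x)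
      cases true r n k x = sym (trans (cong (when n x +_) (when-0 k)) (+-identityʳ _))
      cases false r n k x = sym (trans (cong₂ _+_ (when-0 n) (sym (when-∧ k (not r) x))) (+-identityˡ _))

module Sℕ = ListSum ℕ.+-*-isCommutativeSemiring ℕ.≤-isPreorder ℕ.+-mono-≤
module Sℚ = ListSum (IsCommutativeRing.isCommutativeSemiring ℚ.+-*-isCommutativeRing) ℚ.≤-isPreorder ℚ.+-mono-≤

open Sℕ using () renaming (∑ to ∑ℕ; when to whenℕ)
open Sℚ using () renaming (∑ to ∑ℚ; when to whenℚ)

-- Natural multiples of rationals.

toℚᵘ-ℕtoℚ : ∀ n → ℚ.toℚᵘ (ℕtoℚ n) ℚᵘ.≃ mkℚᵘ (ℤ.+_ n) 0
toℚᵘ-ℕtoℚ n = ℚ.toℚᵘ-fromℚᵘ (mkℚᵘ (ℤ.+_ n) 0)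

-- `ℕtoℚ` normalises its fraction, so additivity is not definitional; among unnormalised rationals
-- it is an identity between integers over the denominator 1.
ℕtoℚ-+ : ∀ a b → ℕtoℚ (a ℕ.+ b) ≡ ℕtoℚ a ℚ.+ ℕtoℚ b
ℕtoℚ-+ a b = ℚ.toℚᵘ-injective (begin
  ℚ.toℚᵘ (ℕtoℚ (a ℕ.+ b))                  ≈⟨ toℚᵘ-ℕtoℚ (a ℕ.+ b) ⟩
  mkℚᵘ (ℤ.+_ (a ℕ.+ b)) 0                     ≈⟨ *≡* (cong (ℤ._* ℤ.1ℤ) (sym (cong₂ ℤ._+_ (ℤ.*-identityʳ (ℤ.+_ a)) (ℤ.*-identityʳ (ℤ.+_ b))))) ⟩
  mkℚᵘ (ℤ.+_ a) 0 ℚᵘ.+ mkℚᵘ (ℤ.+_ b) 0           ≈⟨ ℚᵘ.+-cong (toℚᵘ-ℕtoℚ a) (toℚᵘ-ℕtoℚ b) ⟨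
  ℚ.toℚᵘ (ℕtoℚ a) ℚᵘ.+ ℚ.toℚᵘ (ℕtoℚ b)     ≈⟨ ℚ.toℚᵘ-homo-+ (ℕtoℚ a) (ℕtoℚ b) ⟨
  ℚ.toℚᵘ (ℕtoℚ a ℚ.+ ℕtoℚ b)               ∎)
  where open ℚᵘ.≃-Reasoning

ℕtoℚ-* : ∀ a b → ℕtoℚ (a ℕ.* b) ≡ ℕtoℚ a ℚ.* ℕtoℚ b
ℕtoℚ-* zero b = sym (ℚ.*-zeroˡ (ℕtoℚ b))
ℕtoℚ-* (suc a) b = begin
  ℕtoℚ (b ℕ.+ a ℕ.* b)                  ≡⟨ ℕtoℚ-+ b (a ℕ.* b) ⟩
  ℕtoℚ b ℚ.+ ℕtoℚ (a ℕ.* b)             ≡⟨ cong₂ ℚ._+_ (sym (ℚ.*-identityˡ (ℕtoℚ b))) (ℕtoℚ-* a b) ⟩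
  1ℚ ℚ.* ℕtoℚ b ℚ.+ ℕtoℚ a ℚ.* ℕtoℚ b   ≡⟨ ℚ.*-distribʳ-+ (ℕtoℚ b) 1ℚ (ℕtoℚ a) ⟨
  (1ℚ ℚ.+ ℕtoℚ a) ℚ.* ℕtoℚ b            ≡⟨ cong (ℚ._* ℕtoℚ b) (ℕtoℚ-+ 1 a) ⟨
  ℕtoℚ (suc a) ℚ.* ℕtoℚ b               ∎
  where open ≡-Reasoning

infixl 7 _·_
_·_ : ℕ → ℚ → ℚ
n · x = ℕtoℚ n ℚ.* x

·-+ : ∀ a b x → (a ℕ.+ b) · x ≡ a · x ℚ.+ b · x
·-+ a b x = trans (cong (ℚ._* x) (ℕtoℚ-+ a b)) (ℚ.*-distribʳ-+ x (ℕtoℚ a) (ℕtoℚ b))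

·-suc : ∀ a x → suc a · x ≡ x ℚ.+ a · x
·-suc a x = trans (·-+ 1 a x) (cong (ℚ._+ a · x) (ℚ.*-identityˡ x))

·-∑ : ∀ {A : Set} (xs : List A) (f : A → ℕ) x → ∑ℕ xs f · x ≡ ∑ℚ xs (λ i → f i · x)
·-∑ []       f x = ℚ.*-zeroˡ x
·-∑ (i ∷ xs) f x = trans (·-+ (f i) _ x) (cong (f i · x ℚ.+_) (·-∑ xs f x))

·-when : ∀ b n x → whenℕ b n · x ≡ whenℚ b (n · x)
·-when true  n x = refl
·-when false n x = ℚ.*-zeroˡ x

·-· : ∀ a b x → (a ℕ.* b) · x ≡ a · (b · x)
·-· a b x = trans (cong (ℚ._* x) (ℕtoℚ-* a b)) (ℚ.*-assoc (ℕtoℚ a) (ℕtoℚ b) x)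

0≤· : ∀ n {x} → 0ℚ ℚ.≤ x → 0ℚ ℚ.≤ n · x
0≤· zero    {x} 0≤x = ℚ.≤-reflexive (sym (ℚ.*-zeroˡ x))
0≤· (suc n) {x} 0≤x = subst (0ℚ ℚ.≤_) (sym (·-suc n x)) (ℚ.+-mono-≤ 0≤x (0≤· n 0≤x))

·-monoˡ : ∀ {a b x} → 0ℚ ℚ.≤ x → a ℕ.≤ b → a · x ℚ.≤ b · x
·-monoˡ {a} {b} {x} 0≤x a≤b = begin
  a · x                     ≡⟨ ℚ.+-identityʳ (a · x) ⟨
  a · x ℚ.+ 0ℚ              ≤⟨ ℚ.+-monoʳ-≤ (a · x) (0≤· (b ∸ a) 0≤x) ⟩
  a · x ℚ.+ (b ∸ a) · x     ≡⟨ ·-+ a (b ∸ a) x ⟨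
  (a ℕ.+ (b ∸ a)) · x       ≡⟨ cong (_· x) (ℕ.m+[n∸m]≡n a≤b) ⟩
  b · x                     ∎
  where open ℚ.≤-Reasoning

·-monoʳ : ∀ n {x y} → x ℚ.≤ y → n · x ℚ.≤ n · y
·-monoʳ zero    {x} {y} x≤y = ℚ.≤-reflexive (trans (ℚ.*-zeroˡ x) (sym (ℚ.*-zeroˡ y)))
·-monoʳ (suc n) {x} {y} x≤y = subst₂ ℚ._≤_ (sym (·-suc n x)) (sym (·-suc n y)) (ℚ.+-mono-≤ x≤y (·-monoʳ n x≤y))

-- `geomSum` grows by its highest power, whereas the size of a tree is computed from its root; this
-- Horner form matches the latter recursion.
geomSum-suc : ∀ C k → geomSum C (suc k) ≡ 1 ℕ.+ C ℕ.* geomSum C k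
geomSum-suc C zero    = refl
geomSum-suc C (suc k) = begin
  geomSum C (suc k) ℕ.+ C ℕ.* C ^ suc k              ≡⟨ cong (ℕ._+ C ℕ.* C ^ suc k) (geomSum-suc C k) ⟩
  1 ℕ.+ (C ℕ.* geomSum C k ℕ.+ C ℕ.* C ^ suc k)      ≡⟨ cong suc (ℕ.*-distribˡ-+ C (geomSum C k) (C ^ suc k)) ⟨
  1 ℕ.+ C ℕ.* geomSum C (suc k)                      ∎
  where open ≡-Reasoning

geomSum-mono : ∀ C {j k} → j ℕ.≤′ k → geomSum C j ℕ.≤ geomSum C k
geomSum-mono C ℕ.≤′-refl       = ℕ.≤-refl
geomSum-mono C (ℕ.≤′-step j≤k) = ℕ.≤-trans (geomSum-mono C j≤k) (ℕ.m≤m+n _ _)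

pos : ℕ → Bool
pos zero    = false
pos (suc _) = true

when-pos≤ : ∀ n → whenℕ (pos n) 1 ℕ.≤ n
when-pos≤ zero    = z≤n
when-pos≤ (suc n) = s≤s z≤n

-- Walk counts in a digraph of bounded degree.

module Walks {n : ℕ} {Arc : Set} (arcs : List Arc) (tail head : Arc → Fin n) where

  private
    V : List (Fin n)
    V = allFin n

  outDegree inDegree : Fin n → ℕ
  outDegree u = ∑ℕ arcs (λ α → whenℕ (tail α == u) 1)
  inDegree  v = ∑ℕ arcs (λ α → whenℕ (head α == v) 1)

  -- Multiplicities of nodes in the tree of walks from `u`: on level `k`, and on all levels up to
  -- `k`. Repeated arcs count separately, since the sums run over the list `arcs`. Splitting off the
  -- first arc matches the recursion of `tree`.
  walks walks≤ : ℕ → Fin n → Fin n → ℕ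
  walks zero    u v = whenℕ (u == v) 1
  walks (suc k) u v = ∑ℕ arcs (λ α → whenℕ (tail α == u) (walks k (head α) v))
  walks≤ zero    u v = whenℕ (u == v) 1
  walks≤ (suc k) u v = whenℕ (u == v) 1 ℕ.+ ∑ℕ arcs (λ α → whenℕ (tail α == u) (walks≤ k (head α) v))

  ∑-const : ∀ (xs : List Arc) (b : Arc → Bool) c →
            ∑ℕ xs (λ α → whenℕ (b α) c) ≡ ∑ℕ xs (λ α → whenℕ (b α) 1) ℕ.* c
  ∑-const xs b c = trans
    (Sℕ.∑-cong xs (λ α → trans (cong (whenℕ (b α)) (sym (ℕ.*-identityˡ c))) (Sℕ.when-* (b α) 1 c)))
    (Sℕ.∑-* xs _ c)

  -- The root has at most `C` branches, and each of them is a tree of depth `k` bounded by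
  -- induction.
  ∑-walks≤ : ∀ {C} → (∀ u → outDegree u ℕ.≤ C) → ∀ k u → ∑ℕ V (walks≤ k u) ℕ.≤ geomSum C k
  ∑-walks≤ out≤C zero u = ℕ.≤-reflexive (Sℕ.∑-pick u (λ _ → 1))
  ∑-walks≤ {C} out≤C (suc k) u = begin
    ∑ℕ V (walks≤ (suc k) u)
      ≡⟨ Sℕ.∑-+ V (λ v → whenℕ (u == v) 1) (λ v → ∑ℕ arcs (λ α → whenℕ (tail α == u) (walks≤ k (head α) v))) ⟩
    ∑ℕ V (λ v → whenℕ (u == v) 1) ℕ.+ ∑ℕ V (λ v → ∑ℕ arcs (λ α → whenℕ (tail α == u) (walks≤ k (head α) v)))
      ≡⟨ cong₂ ℕ._+_ (Sℕ.∑-pick u (λ _ → 1)) (Sℕ.∑-swap V arcs _) ⟩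
    1 ℕ.+ ∑ℕ arcs (λ α → ∑ℕ V (λ v → whenℕ (tail α == u) (walks≤ k (head α) v)))
      ≡⟨ cong suc (Sℕ.∑-cong arcs (λ α → Sℕ.∑-when V (tail α == u) _)) ⟩
    1 ℕ.+ ∑ℕ arcs (λ α → whenℕ (tail α == u) (∑ℕ V (walks≤ k (head α))))
      ≤⟨ s≤s (Sℕ.∑-mono arcs (λ α → Sℕ.when-mono (tail α == u) (∑-walks≤ out≤C k (head α)))) ⟩
    1 ℕ.+ ∑ℕ arcs (λ α → whenℕ (tail α == u) (geomSum C k))
      ≡⟨ cong suc (∑-const arcs _ (geomSum C k)) ⟩
    1 ℕ.+ outDegree u ℕ.* geomSum C k
      ≤⟨ s≤s (ℕ.*-monoˡ-≤ (geomSum C k) (out≤C u)) ⟩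
    1 ℕ.+ C ℕ.* geomSum C k
      ≡⟨ geomSum-suc C k ⟨
    geomSum C (suc k) ∎
    where open ℕ.≤-Reasoning

  -- Prepending a fixed arc x → y at the far end maps the walks from u to x that are not of
  -- full length injectively to nonempty walks from u to y; the empty walk at y is left over.
  walks≤-arc : ∀ k u (α : Arc) → α ∈ arcs →
    walks≤ k u (tail α) ℕ.+ whenℕ (u == head α) 1 ℕ.≤ walks≤ k u (head α) ℕ.+ walks k u (tail α)
  walks≤-arc zero u α α∈ = ℕ.≤-reflexive (ℕ.+-comm (whenℕ (u == tail α) 1) _)
  walks≤-arc (suc k) u α α∈ = begin
    (origin (tail α) ℕ.+ rest (tail α)) ℕ.+ origin (head α)
      -- If `u` is the tail of `α`, the empty walk at `u` is charged to `α` as a first arc.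
      -- Distributed over the first arcs `β`, this supplies the term for the empty walk that the
      -- induction hypothesis at `head β` has on its left side.
      ≤⟨ ℕ.+-monoˡ-≤ (origin (head α)) (ℕ.+-monoˡ-≤ (rest (tail α)) arc-counted) ⟩
    (∑ℕ arcs (λ β → whenℕ (tail β == u) (whenℕ (head β == head α) 1)) ℕ.+ rest (tail α)) ℕ.+ origin (head α)
      ≡⟨ cong (ℕ._+ origin (head α)) (trans (ℕ.+-comm _ (rest (tail α))) (sym (Sℕ.∑-+ arcs _ _))) ⟩
    ∑ℕ arcs (λ β → whenℕ (tail β == u) (walks≤ k (head β) (tail α)) ℕ.+ whenℕ (tail β == u) (whenℕ (head β == head α) 1)) ℕ.+ origin (head α)
      ≤⟨ ℕ.+-monoˡ-≤ (origin (head α)) (Sℕ.∑-mono arcs (λ β → subst₂ ℕ._≤_ (Sℕ.when-+ (tail β == u) _ _) (Sℕ.when-+ (tail β == u) _ _)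
           (Sℕ.when-mono (tail β == u) (walks≤-arc k (head β) α α∈)))) ⟩
    ∑ℕ arcs (λ β → whenℕ (tail β == u) (walks≤ k (head β) (head α)) ℕ.+ whenℕ (tail β == u) (walks k (head β) (tail α))) ℕ.+ origin (head α)
      ≡⟨ cong (ℕ._+ origin (head α)) (Sℕ.∑-+ arcs _ _) ⟩
    (rest (head α) ℕ.+ walks (suc k) u (tail α)) ℕ.+ origin (head α)
      ≡⟨ rearrange (rest (head α)) (walks (suc k) u (tail α)) (origin (head α)) ⟩
    (origin (head α) ℕ.+ rest (head α)) ℕ.+ walks (suc k) u (tail α) ∎
    where
    open ℕ.≤-Reasoning
    origin rest : Fin n → ℕ
    origin v = whenℕ (u == v) 1
    rest  v = ∑ℕ arcs (λ β → whenℕ (tail β == u) (walks≤ k (head β) v))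
    rearrange : ∀ a b c → (a ℕ.+ b) ℕ.+ c ≡ (c ℕ.+ a) ℕ.+ b
    rearrange = solve-∀
    term : ∀ {xs : List Arc} → α ∈ xs → (f : Arc → ℕ) → f α ℕ.≤ ∑ℕ xs f
    term (here refl) f = ℕ.m≤m+n _ _
    term (there i)   f = ℕ.≤-trans (term i f) (ℕ.m≤n+m _ _)
    arc-counted : origin (tail α) ℕ.≤ ∑ℕ arcs (λ β → whenℕ (tail β == u) (whenℕ (head β == head α) 1))
    arc-counted = ℕ.≤-trans
      (ℕ.≤-reflexive (cong₂ whenℕ (==-sym u (tail α)) (cong (λ b → whenℕ b 1) (sym (==-refl (head α))))))
      (term α∈ (λ β → whenℕ (tail β == u) (whenℕ (head β == head α) 1)))

  -- Averaging cut inequalities over trees of walks.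

  module Averaging (gain : Fin n → ℚ) (w : Arc → ℚ) (0≤w : ∀ α → 0ℚ ℚ.≤ w α) where

    Cut≥0 : (Fin n → Bool) → Set
    Cut≥0 S = 0ℚ ℚ.≤ ∑ℚ V (λ v → whenℚ (S v) (gain v))
                       ℚ.+ ∑ℚ arcs (λ α → whenℚ (S (tail α) ∧ not (S (head α))) (w α))

    -- A multiplicity function is the sum of the indicators of its level sets, all contained in its
    -- support and hence small enough for `cut`. An arc leaves as many level sets as `m` drops along
    -- it, which is the truncated difference. The induction strips off the support and lowers `m` by
    -- one.
    layer-cake : ∀ {ρ} → (∀ S → ∑ℕ V (λ v → whenℕ (S v) 1) ℕ.≤ ρ → Cut≥0 S) →
      ∀ J (m : Fin n → ℕ) → (∀ v → m v ℕ.≤ J) → ∑ℕ V (λ v → whenℕ (pos (m v)) 1) ℕ.≤ ρ →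
      0ℚ ℚ.≤ ∑ℚ V (λ v → m v · gain v) ℚ.+ ∑ℚ arcs (λ α → (m (tail α) ∸ m (head α)) · w α)
    layer-cake cut zero m m≤J small = ℚ.+-mono-≤
      (Sℚ.0≤∑ V (λ v → ℚ.≤-reflexive (sym (trans (cong (_· gain v) (ℕ.n≤0⇒n≡0 (m≤J v))) (ℚ.*-zeroˡ (gain v))))))
      (Sℚ.0≤∑ arcs (λ α → 0≤· (m (tail α) ∸ m (head α)) (0≤w α)))
    layer-cake cut (suc J) m m≤J small = begin
      0ℚ ℚ.+ 0ℚ
        ≤⟨ ℚ.+-mono-≤ (cut (pos ∘ m) small)
             (layer-cake cut J (ℕ.pred ∘ m) (λ v → ℕ.pred-mono-≤ (m≤J v))
               (ℕ.≤-trans (Sℕ.∑-mono V (λ v → pos-pred (m v))) small)) ⟩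
      (∑ℚ V g₀ ℚ.+ ∑ℚ arcs w₀) ℚ.+ (∑ℚ V g₁ ℚ.+ ∑ℚ arcs w₁)
        ≡⟨ interchange (∑ℚ V g₀) (∑ℚ arcs w₀) (∑ℚ V g₁) (∑ℚ arcs w₁) ⟩
      (∑ℚ V g₀ ℚ.+ ∑ℚ V g₁) ℚ.+ (∑ℚ arcs w₀ ℚ.+ ∑ℚ arcs w₁)
        ≡⟨ cong₂ ℚ._+_
             (trans (sym (Sℚ.∑-+ V g₀ g₁)) (Sℚ.∑-cong V (λ v → sym (peel (m v) (gain v)))))
             (trans (sym (Sℚ.∑-+ arcs w₀ w₁)) (Sℚ.∑-cong arcs (λ α → sym (peel-∸ (m (tail α)) (m (head α)) (w α))))) ⟩
      ∑ℚ V (λ v → m v · gain v) ℚ.+ ∑ℚ arcs (λ α → (m (tail α) ∸ m (head α)) · w α) ∎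
      where
      open ℚ.≤-Reasoning
      open +-*-Solver
      g₀ g₁ : Fin n → ℚ
      g₀ v = whenℚ (pos (m v)) (gain v)
      g₁ v = ℕ.pred (m v) · gain v
      w₀ w₁ : Arc → ℚ
      w₀ α = whenℚ (pos (m (tail α)) ∧ not (pos (m (head α)))) (w α)
      w₁ α = (ℕ.pred (m (tail α)) ∸ ℕ.pred (m (head α))) · w α
      interchange : ∀ a b c d → (a ℚ.+ b) ℚ.+ (c ℚ.+ d) ≡ (a ℚ.+ c) ℚ.+ (b ℚ.+ d)
      interchange = solve 4 (λ a b c d → (a :+ b) :+ (c :+ d) := (a :+ c) :+ (b :+ d)) refl
      pos-pred : ∀ k → whenℕ (pos (ℕ.pred k)) 1 ℕ.≤ whenℕ (pos k) 1
      pos-pred zero          = z≤n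
      pos-pred (suc zero)    = z≤n
      pos-pred (suc (suc k)) = s≤s z≤n
      peel : ∀ a x → a · x ≡ whenℚ (pos a) x ℚ.+ ℕ.pred a · x
      peel zero    x = sym (ℚ.+-identityˡ _)
      peel (suc a) x = ·-suc a x
      -- The support is left by an arc exactly if `m` is positive at the tail and zero at the head;
      -- otherwise lowering both values keeps the truncated difference.
      peel-∸ : ∀ a b x → (a ∸ b) · x ≡ whenℚ (pos a ∧ not (pos b)) x ℚ.+ (ℕ.pred a ∸ ℕ.pred b) · x
      peel-∸ zero    b       x = trans (cong (_· x) (trans (ℕ.0∸n≡0 b) (sym (ℕ.0∸n≡0 (ℕ.pred b))))) (sym (ℚ.+-identityˡ _))
      peel-∸ (suc a) zero    x = ·-suc a x
      peel-∸ (suc a) (suc b) x = sym (ℚ.+-identityˡ _)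

    tree : ℕ → Fin n → ℚ
    tree zero    u = gain u ℚ.+ ∑ℚ arcs (λ α → whenℚ (tail α == u) (w α))
    tree (suc k) u = gain u ℚ.+ ∑ℚ arcs (λ α → whenℚ (tail α == u) (tree k (head α)))

    private
      unit : ∀ b x → whenℕ b 1 · x ≡ whenℚ b x
      unit b x = trans (·-when b 1 x) (cong (whenℚ b) (ℚ.*-identityˡ x))

      start-gain : ∀ u → ∑ℚ V (λ v → whenℕ (u == v) 1 · gain v) ≡ gain u
      start-gain u = trans (Sℚ.∑-cong V (λ v → unit (u == v) (gain v))) (Sℚ.∑-pick u gain)

    -- Collects equal nodes and equal outgoing arcs of the tree. The recursive form is the one to
    -- sum over all roots, the form with multiplicities is the one to slice by `layer-cake`.
    tree-walks : ∀ k u →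
      tree k u ≡ ∑ℚ V (λ v → walks≤ k u v · gain v) ℚ.+ ∑ℚ arcs (λ α → walks k u (tail α) · w α)
    tree-walks zero u = cong₂ ℚ._+_ (sym (start-gain u))
      (Sℚ.∑-cong arcs (λ α → trans (cong (λ b → whenℚ b (w α)) (==-sym (tail α) u)) (sym (unit (u == tail α) (w α)))))
    tree-walks (suc k) u = begin
      gain u ℚ.+ ∑ℚ arcs (λ β → whenℚ (tail β == u) (tree k (head β)))
        ≡⟨ cong (gain u ℚ.+_) (trans
             (Sℚ.∑-cong arcs (λ β → trans (cong (whenℚ (tail β == u)) (tree-walks k (head β)))
               (Sℚ.when-+ (tail β == u) (nodes (head β)) (leaves (head β)))))
             (Sℚ.∑-+ arcs (λ β → whenℚ (tail β == u) (nodes (head β))) (λ β → whenℚ (tail β == u) (leaves (head β))))) ⟩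
      gain u ℚ.+ (∑ℚ arcs (λ β → whenℚ (tail β == u) (nodes (head β))) ℚ.+ ∑ℚ arcs (λ β → whenℚ (tail β == u) (leaves (head β))))
        ≡⟨ ℚ.+-assoc (gain u) _ _ ⟨
      (gain u ℚ.+ ∑ℚ arcs (λ β → whenℚ (tail β == u) (nodes (head β)))) ℚ.+ ∑ℚ arcs (λ β → whenℚ (tail β == u) (leaves (head β)))
        ≡⟨ cong₂ ℚ._+_
             (trans (cong₂ ℚ._+_ (sym (start-gain u)) (first-arc V (λ β v → walks≤ k (head β) v) gain))
                    (trans (sym (Sℚ.∑-+ V (λ v → whenℕ (u == v) 1 · gain v)
                                  (λ v → ∑ℕ arcs (λ β → whenℕ (tail β == u) (walks≤ k (head β) v)) · gain v)))
                           (Sℚ.∑-cong V (λ v → sym (·-+ (whenℕ (u == v) 1) _ (gain v))))))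
             (first-arc arcs (λ β α → walks k (head β) (tail α)) w) ⟩
      ∑ℚ V (λ v → walks≤ (suc k) u v · gain v) ℚ.+ ∑ℚ arcs (λ α → walks (suc k) u (tail α) · w α) ∎
      where
      open ≡-Reasoning
      nodes leaves : Fin n → ℚ
      nodes  x = ∑ℚ V (λ v → walks≤ k x v · gain v)
      leaves x = ∑ℚ arcs (λ α → walks k x (tail α) · w α)
      -- The index type is left open because the exchange of sums is used for nodes and for arcs
      -- alike.
      first-arc : ∀ {X : Set} (xs : List X) (f : Arc → X → ℕ) (x : X → ℚ) →
        ∑ℚ arcs (λ β → whenℚ (tail β == u) (∑ℚ xs (λ i → f β i · x i)))
        ≡ ∑ℚ xs (λ i → ∑ℕ arcs (λ β → whenℕ (tail β == u) (f β i)) · x i)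
      first-arc xs f x = begin
        ∑ℚ arcs (λ β → whenℚ (tail β == u) (∑ℚ xs (λ i → f β i · x i)))
          ≡⟨ Sℚ.∑-cong arcs (λ β → trans (sym (Sℚ.∑-when xs (tail β == u) (λ i → f β i · x i)))
               (Sℚ.∑-cong xs (λ i → sym (·-when (tail β == u) (f β i) (x i))))) ⟩
        ∑ℚ arcs (λ β → ∑ℚ xs (λ i → whenℕ (tail β == u) (f β i) · x i))
          ≡⟨ Sℚ.∑-swap arcs xs (λ β i → whenℕ (tail β == u) (f β i) · x i) ⟩
        ∑ℚ xs (λ i → ∑ℚ arcs (λ β → whenℕ (tail β == u) (f β i) · x i))
          ≡⟨ Sℚ.∑-cong xs (λ i → sym (·-∑ arcs (λ β → whenℕ (tail β == u) (f β i)) (x i))) ⟩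
        ∑ℚ xs (λ i → ∑ℕ arcs (λ β → whenℕ (tail β == u) (f β i)) · x i) ∎

    module _ {C d : ℕ} (out≤C : ∀ u → outDegree u ℕ.≤ C) (in≤C : ∀ v → inDegree v ℕ.≤ C)
      (cut : ∀ S → ∑ℕ V (λ v → whenℕ (S v) 1) ℕ.≤ geomSum C d → Cut≥0 S) where

      -- Slice the multiplicities `walks≤ k u`. Their total is at most `geomSum C d`, so the support
      -- is small enough, and by `walks≤-arc` they drop along an arc by at most the number of leaves
      -- at its tail.
      0≤tree : ∀ {k} → k ℕ.≤ d → ∀ u → 0ℚ ℚ.≤ tree k u
      0≤tree {k} k≤d u = begin
        0ℚ
          -- Any common bound on the multiplicities can serve as the number of levels; their total
          -- is one.
          ≤⟨ layer-cake cut (∑ℕ V (walks≤ k u)) (walks≤ k u) term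
               (ℕ.≤-trans (Sℕ.∑-mono V (λ v → when-pos≤ (walks≤ k u v)))
                 (ℕ.≤-trans (∑-walks≤ out≤C k u) (geomSum-mono C (ℕ.≤⇒≤′ k≤d)))) ⟩
        ∑ℚ V (λ v → walks≤ k u v · gain v) ℚ.+ ∑ℚ arcs (λ α → (walks≤ k u (tail α) ∸ walks≤ k u (head α)) · w α)
          ≤⟨ ℚ.+-monoʳ-≤ (∑ℚ V (λ v → walks≤ k u v · gain v)) (boundary arcs (λ _ → id)) ⟩
        ∑ℚ V (λ v → walks≤ k u v · gain v) ℚ.+ ∑ℚ arcs (λ α → walks k u (tail α) · w α)
          ≡⟨ tree-walks k u ⟨
        tree k u ∎
        where
        open ℚ.≤-Reasoning
        term : ∀ v → walks≤ k u v ℕ.≤ ∑ℕ V (walks≤ k u)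
        term v = ℕ.≤-trans (ℕ.≤-reflexive (sym (Sℕ.∑-pick v (walks≤ k u))))
          (Sℕ.∑-mono V (λ x → Sℕ.when≤ (v == x) z≤n))
        -- The comparison of terms needs `α ∈ arcs`, so the induction runs over sublists and carries
        -- the inclusion along.
        boundary : ∀ (as : List Arc) → (∀ α → α ∈ as → α ∈ arcs) →
          ∑ℚ as (λ α → (walks≤ k u (tail α) ∸ walks≤ k u (head α)) · w α)
          ℚ.≤ ∑ℚ as (λ α → walks k u (tail α) · w α)
        boundary []       as⊆ = ℚ.≤-refl
        boundary (α ∷ as) as⊆ = ℚ.+-mono-≤
          -- The term for the empty walk, which made the induction in `walks≤-arc` go through, is
          -- dropped here.
          (·-monoˡ (0≤w α) (ℕ.m≤n+o⇒m∸n≤o (walks≤ k u (tail α)) (walks≤ k u (head α))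
            (ℕ.≤-trans (ℕ.m≤m+n _ _) (walks≤-arc k u α (as⊆ α (here refl))))))
          (boundary as (λ β → as⊆ β ∘ there))

      ∑-tree : ∀ k → k ℕ.≤ d → ∑ℚ V (tree k) ℚ.≤ geomSum C k · ∑ℚ V gain ℚ.+ C ^ k · ∑ℚ arcs w
      ∑-tree zero _ = ℚ.≤-reflexive (trans (Sℚ.∑-+ V gain _)
        (cong₂ ℚ._+_ (sym (ℚ.*-identityˡ (∑ℚ V gain))) (trans (Sℚ.∑-fibre arcs tail w) (sym (ℚ.*-identityˡ (∑ℚ arcs w))))))
      ∑-tree (suc k) k<d = begin
        ∑ℚ V (tree (suc k))
          ≡⟨ trans (Sℚ.∑-+ V gain _) (cong (∑ℚ V gain ℚ.+_) (Sℚ.∑-fibre arcs tail (tree k ∘ head))) ⟩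
        ∑ℚ V gain ℚ.+ ∑ℚ arcs (tree k ∘ head)
          -- Regrouped by heads, the tree at `v` is counted once for every arc entering `v`.
          ≡⟨ cong (∑ℚ V gain ℚ.+_) (sym (Sℚ.∑-fibre arcs head (tree k ∘ head))) ⟩
        ∑ℚ V gain ℚ.+ ∑ℚ V (λ v → ∑ℚ arcs (λ α → whenℚ (head α == v) (tree k (head α))))
          ≡⟨ cong (∑ℚ V gain ℚ.+_) (Sℚ.∑-cong V collect) ⟩
        ∑ℚ V gain ℚ.+ ∑ℚ V (λ v → inDegree v · tree k v)
          -- Replacing the indegree by `C` relies on `tree k v` being nonnegative, which is why
          -- `0≤tree` covers every depth up to `d`.
          ≤⟨ ℚ.+-monoʳ-≤ (∑ℚ V gain) (Sℚ.∑-mono V (λ v → ·-monoˡ (0≤tree (ℕ.<⇒≤ k<d) v) (in≤C v))) ⟩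
        ∑ℚ V gain ℚ.+ ∑ℚ V (λ v → C · tree k v)
          ≡⟨ cong (∑ℚ V gain ℚ.+_) (Sℚ.∑-*ˡ V (ℕtoℚ C) (tree k)) ⟩
        ∑ℚ V gain ℚ.+ C · ∑ℚ V (tree k)
          ≤⟨ ℚ.+-monoʳ-≤ (∑ℚ V gain) (·-monoʳ C (∑-tree k (ℕ.<⇒≤ k<d))) ⟩
        ∑ℚ V gain ℚ.+ C · (geomSum C k · ∑ℚ V gain ℚ.+ C ^ k · ∑ℚ arcs w)
          ≡⟨ expand (ℕtoℚ C) (ℕtoℚ (geomSum C k)) (ℕtoℚ (C ^ k)) (∑ℚ V gain) (∑ℚ arcs w) ⟩
        (1ℚ ℚ.+ ℕtoℚ C ℚ.* ℕtoℚ (geomSum C k)) ℚ.* ∑ℚ V gain ℚ.+ (ℕtoℚ C ℚ.* ℕtoℚ (C ^ k)) ℚ.* ∑ℚ arcs w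
          ≡⟨ cong₂ (λ a b → a ℚ.* ∑ℚ V gain ℚ.+ b ℚ.* ∑ℚ arcs w)
               (sym (trans (cong ℕtoℚ (geomSum-suc C k)) (trans (ℕtoℚ-+ 1 (C ℕ.* geomSum C k)) (cong (1ℚ ℚ.+_) (ℕtoℚ-* C (geomSum C k))))))
               (sym (ℕtoℚ-* C (C ^ k))) ⟩
        geomSum C (suc k) · ∑ℚ V gain ℚ.+ C ^ suc k · ∑ℚ arcs w ∎
        where
        open ℚ.≤-Reasoning
        open +-*-Solver
        expand : ∀ c a b x y → x ℚ.+ c ℚ.* (a ℚ.* x ℚ.+ b ℚ.* y) ≡ (1ℚ ℚ.+ c ℚ.* a) ℚ.* x ℚ.+ (c ℚ.* b) ℚ.* y
        expand = solve 5 (λ c a b x y → x :+ c :* (a :* x :+ b :* y) := (con 1ℚ :+ c :* a) :* x :+ (c :* b) :* y) refl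
        collect : ∀ v → ∑ℚ arcs (λ α → whenℚ (head α == v) (tree k (head α))) ≡ inDegree v · tree k v
        collect v = trans
          (Sℚ.∑-cong arcs (λ α → same (head α)))
          (sym (·-∑ arcs _ (tree k v)))
          where
          same : ∀ u → whenℚ (u == v) (tree k u) ≡ whenℕ (u == v) 1 · tree k v
          same u with u == v in eq
          ... | true  = trans (cong (tree k) (==⇒≡ u v eq)) (sym (ℚ.*-identityˡ (tree k v)))
          ... | false = sym (ℚ.*-zeroˡ (tree k v))

      averaging : 0ℚ ℚ.≤ geomSum C d · ∑ℚ V gain ℚ.+ C ^ d · ∑ℚ arcs w
      averaging = ℚ.≤-trans (Sℚ.0≤∑ V (0≤tree ℕ.≤-refl)) (∑-tree d ℕ.≤-refl)

-- Boolean conjunctions, capacities and exclusive pairs.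

∧-true⁻ : ∀ {a b} → a ∧ b ≡ true → a ≡ true × b ≡ true
∧-true⁻ {true} {true} refl = refl , refl

foldr-∧⁻ : ∀ {A : Set} (f : A → Bool) xs → foldr (λ x b → f x ∧ b) true xs ≡ true →
           ∀ {x} → x ∈ xs → f x ≡ true
foldr-∧⁻ f (x ∷ xs) eq (here refl) = proj₁ (∧-true⁻ eq)
foldr-∧⁻ f (x ∷ xs) eq (there x∈)  = foldr-∧⁻ f xs (proj₂ (∧-true⁻ {f x} eq)) x∈

foldr-∧⁺ : ∀ {A : Set} (f : A → Bool) xs → (∀ {x} → x ∈ xs → f x ≡ true) →
           foldr (λ x b → f x ∧ b) true xs ≡ true
foldr-∧⁺ f []       f≡t = refl
foldr-∧⁺ f (x ∷ xs) f≡t = cong₂ _∧_ (f≡t (here refl)) (foldr-∧⁺ f xs (f≡t ∘ there))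

any⁺ : ∀ {A : Set} (f : A → Bool) {xs x} → x ∈ xs → f x ≡ true → any f xs ≡ true
any⁺ f {x ∷ xs} (here refl) eq rewrite eq = refl
any⁺ f {y ∷ xs} (there x∈)  eq with f y
... | true  = refl
... | false = any⁺ f x∈ eq

length-∑ : ∀ {A : Set} (xs : List A) → length xs ≡ ∑ℕ xs (λ _ → 1)
length-∑ []       = refl
length-∑ (x ∷ xs) = cong suc (length-∑ xs)

length-filter-∑ : ∀ {A : Set} {P : A → Set} (P? : ∀ x → Dec (P x)) xs →
                  length (filter P? xs) ≡ ∑ℕ xs (λ x → whenℕ (does (P? x)) 1)
length-filter-∑ P? xs = trans (length-∑ (filter P? xs)) (Sℕ.∑-filter P? xs (λ _ → 1))

∑-neg : ∀ {A : Set} (xs : List A) (f : A → ℚ) → ∑ℚ xs (λ x → ℚ.- f x) ≡ ℚ.- ∑ℚ xs f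
∑-neg []       f = refl
∑-neg (x ∷ xs) f = trans (cong (ℚ.- f x ℚ.+_) (∑-neg xs f)) (sym (ℚ.neg-distrib-+ (f x) (∑ℚ xs f)))

when-neg : ∀ b x → whenℚ b (ℚ.- x) ≡ ℚ.- whenℚ b x
when-neg true  x = refl
when-neg false x = refl

capOK-mono : ∀ c {j k} → j ℕ.≤ k → capOK k c ≡ true → capOK j c ≡ true
capOK-mono ∞       j≤k ok = refl
capOK-mono (fin c) {j} {k} j≤k ok =
  Equivalence.to T-≡ (ℕ.≤⇒≤ᵇ (ℕ.≤-trans j≤k (ℕ.≤ᵇ⇒≤ k c (Equivalence.from T-≡ ok))))

capOK-⊔ : ∀ c {j k} → capOK j c ≡ true → capOK k c ≡ true → capOK (j ℕ.⊔ k) c ≡ true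
capOK-⊔ c {j} {k} okj okk with ℕ.⊔-sel j k
... | inj₁ eq rewrite eq = okj
... | inj₂ eq rewrite eq = okk

capOK-CapLe : ∀ c {k C} → CapLe c C → capOK k c ≡ true → k ℕ.≤ C
capOK-CapLe (fin c) {k} c≤C ok = ℕ.≤-trans (ℕ.≤ᵇ⇒≤ k c (Equivalence.from T-≡ ok)) c≤C

-- Each zipped pair contributes at most one, and so does each entry of the longer list beyond the
-- zip; together these slots number the maximum of the lengths.
∑-zip-exclusive : ∀ {A B : Set} (xs : List A) (ys : List B) (a : A → Bool) (b : B → Bool) →
  (∀ {x y} → (x , y) ∈ zip xs ys → a x ≡ true → b y ≡ false) →
  ∑ℕ xs (λ x → whenℕ (a x) 1) ℕ.+ ∑ℕ ys (λ y → whenℕ (b y) 1) ℕ.≤ length xs ℕ.⊔ length ys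
∑-zip-exclusive [] ys a b excl = begin
  ∑ℕ ys (λ y → whenℕ (b y) 1)   ≤⟨ Sℕ.∑-mono ys (λ y → Sℕ.when≤ (b y) z≤n) ⟩
  ∑ℕ ys (λ _ → 1)               ≡⟨ length-∑ ys ⟨
  length ys                     ∎
  where open ℕ.≤-Reasoning
∑-zip-exclusive xs@(_ ∷ _) [] a b excl = begin
  ∑ℕ xs (λ x → whenℕ (a x) 1) ℕ.+ 0   ≡⟨ ℕ.+-identityʳ _ ⟩
  ∑ℕ xs (λ x → whenℕ (a x) 1)         ≤⟨ Sℕ.∑-mono xs (λ x → Sℕ.when≤ (a x) z≤n) ⟩
  ∑ℕ xs (λ _ → 1)                     ≡⟨ length-∑ xs ⟨
  length xs                           ∎
  where open ℕ.≤-Reasoning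
∑-zip-exclusive (x ∷ xs) (y ∷ ys) a b excl = begin
  (whenℕ (a x) 1 ℕ.+ A) ℕ.+ (whenℕ (b y) 1 ℕ.+ B)   ≡⟨ interchange (whenℕ (a x) 1) A (whenℕ (b y) 1) B ⟩
  (whenℕ (a x) 1 ℕ.+ whenℕ (b y) 1) ℕ.+ (A ℕ.+ B)
    ≤⟨ ℕ.+-mono-≤ (one (a x) (b y) (excl (here refl))) (∑-zip-exclusive xs ys a b (excl ∘ there)) ⟩
  suc (length xs ℕ.⊔ length ys)                     ∎
  where
  open ℕ.≤-Reasoning
  A B : ℕ
  A = ∑ℕ xs (λ x → whenℕ (a x) 1)
  B = ∑ℕ ys (λ y → whenℕ (b y) 1)
  interchange : ∀ i j k l → (i ℕ.+ j) ℕ.+ (k ℕ.+ l) ≡ (i ℕ.+ k) ℕ.+ (j ℕ.+ l)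
  interchange = solve-∀
  one : ∀ s t → (s ≡ true → t ≡ false) → whenℕ s 1 ℕ.+ whenℕ t 1 ℕ.≤ 1
  one false t     _    = Sℕ.when≤ t z≤n
  one true  t s⇒¬t rewrite s⇒¬t refl = s≤s z≤n

-- Feasible edge sets and the value of a pricing.

module _ (I : Instance) where
  open Instance I

  0≤pricing : (r : Pricing I) → ∀ u → 0ℚ ℚ.≤ proj₁ r u
  0≤pricing (r , r-ok) u with r-ok u
  ... | e , _ , eq = subst (0ℚ ℚ.≤_) (sym eq) (budget≥0 e)

  Feasible : (Fin nL → ℚ) → EdgeSet I → Set
  Feasible p F = (∀ e → lookup F e ≡ true → p (left e) ℚ.≤ budget e)
               × (∀ u → capOK (degL I F u) (μL u) ≡ true)
               × (∀ v → capOK (degR I F v) (μR v) ≡ true)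

  private
    priceOK : (Fin nL → ℚ) → Fin m → Bool
    priceOK p e = p (left e) ℚ.≤ᵇ budget e

    capLOK : EdgeSet I → Fin nL → Bool
    capLOK F u = capOK (degL I F u) (μL u)

    capROK : EdgeSet I → Fin nR → Bool
    capROK F v = capOK (degR I F v) (μR v)

  feasible⇒Feasible : ∀ p F → feasible I p F ≡ true → Feasible p F
  feasible⇒Feasible p F eq =
    let prices , caps = ∧-true⁻ {foldr (λ e b → priceOK p e ∧ b) true (edges I F)} eq
        capsL , capsR = ∧-true⁻ {allB I (capLOK F)} caps
    in (λ e e∈F → ℚ.≤ᵇ⇒≤ (Equivalence.from T-≡ (foldr-∧⁻ (priceOK p) (edges I F) prices
         (∈-filter⁺ (λ e → lookup F e Bool.≟ true) (∈-allFin e) e∈F))))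
     , (λ u → foldr-∧⁻ (capLOK F) (allFin nL) capsL (∈-allFin u))
     , (λ v → foldr-∧⁻ (capROK F) (allFin nR) capsR (∈-allFin v))

  Feasible⇒feasible : ∀ p F → Feasible p F → feasible I p F ≡ true
  Feasible⇒feasible p F (prices , capsL , capsR) = cong₂ _∧_
    (foldr-∧⁺ (priceOK p) (edges I F) (λ {e} e∈ → Equivalence.to T-≡ (ℚ.≤⇒≤ᵇ (prices e
      (proj₂ (∈-filter⁻ (λ e → lookup F e Bool.≟ true) {xs = allFin m} e∈))))))
    (cong₂ _∧_ (foldr-∧⁺ (capLOK F) (allFin nL) (λ {u} _ → capsL u))
               (foldr-∧⁺ (capROK F) (allFin nR) (λ {v} _ → capsR v)))

  ∈-allSubsets : ∀ {n} (F : Vec Bool n) → F ∈ allSubsets I n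
  ∈-allSubsets Vec.[]          = here refl
  ∈-allSubsets (true Vec.∷ F)  = ∈-++⁺ˡ (∈-map⁺ (true Vec.∷_) (∈-allSubsets F))
  ∈-allSubsets (false Vec.∷ F) = ∈-++⁺ʳ _ (∈-map⁺ (false Vec.∷_) (∈-allSubsets F))

  revenue≤val : ∀ p F → Feasible p F → revenue I p F ℚ.≤ val I p
  revenue≤val p F feas = below (allSubsets I m) (∈-allSubsets F)
    where
    value : EdgeSet I → ℚ
    value G = if feasible I p G then revenue I p G else 0ℚ
    below : ∀ Fs → F ∈ Fs → revenue I p F ℚ.≤ foldr (λ G s → value G ℚ.⊔ s) 0ℚ Fs
    below (G ∷ Fs) (there F∈) = ℚ.≤-trans (below Fs F∈) (ℚ.p≤q⊔p (value G) _)
    below (G ∷ Fs) (here refl) = ℚ.≤-trans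
      (ℚ.≤-reflexive (cong (λ b → if b then revenue I p F else 0ℚ) (sym (Feasible⇒feasible p F feas))))
      (ℚ.p≤p⊔q (value G) _)

  module _ (p : Fin nL → ℚ) (0≤p : ∀ u → 0ℚ ℚ.≤ p u) where

    revenue≥0 : ∀ F → 0ℚ ℚ.≤ revenue I p F
    revenue≥0 F = Sℚ.0≤∑ (edges I F) (λ e → ℚ.+-mono-≤ (0≤p (left e)) ℚ.≤-refl)

    -- The fold defining `val` starts from `0ℚ`, a value that the empty edge set reaches; each
    -- further step either keeps the best set so far or moves to a feasible one.
    val-attained : Σ (EdgeSet I) λ F → Feasible p F × val I p ℚ.≤ revenue I p F
    val-attained = attained (allSubsets I m)
      where
      ∅ : EdgeSet I
      ∅ = Vec.replicate m false
      no-edge : ∀ e → lookup ∅ e ≢ true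
      no-edge e eq with trans (sym (lookup-replicate e false)) eq
      ... | ()
      edges-∅ : edges I ∅ ≡ []
      edges-∅ with edges I ∅ in eq
      ... | []    = refl
      ... | e ∷ _ = contradiction
        (proj₂ (∈-filter⁻ (λ e → lookup ∅ e Bool.≟ true) {xs = allFin m} (subst (e ∈_) (sym eq) (here refl))))
        (no-edge e)
      capOK-0 : ∀ c → capOK 0 c ≡ true
      capOK-0 (fin c) = refl
      capOK-0 ∞       = refl
      ∅-feasible : Feasible p ∅
      ∅-feasible = (λ e e∈ → contradiction e∈ (no-edge e))
        , (λ u → trans (cong (λ es → capOK (length (filter (λ e → left e ≟F u) es)) (μL u)) edges-∅) (capOK-0 (μL u)))
        , (λ v → trans (cong (λ es → capOK (length (filter (λ e → right e ≟F v) es)) (μR v)) edges-∅) (capOK-0 (μR v)))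
      value : EdgeSet I → ℚ
      value G = if feasible I p G then revenue I p G else 0ℚ
      attained : ∀ Fs → Σ (EdgeSet I) λ F → Feasible p F × foldr (λ G s → value G ℚ.⊔ s) 0ℚ Fs ℚ.≤ revenue I p F
      attained [] = ∅ , ∅-feasible , revenue≥0 ∅
      attained (G ∷ Fs) with attained Fs | ℚ.⊔-sel (value G) (foldr (λ G s → value G ℚ.⊔ s) 0ℚ Fs)
      ... | F , feas , le | inj₂ eq = F , feas , ℚ.≤-trans (ℚ.≤-reflexive eq) le
      ... | F , feas , le | inj₁ eq with feasible I p G in feasG
      ...   | true  = G , feasible⇒Feasible p G feasG , ℚ.≤-reflexive eq
      -- An infeasible `G` enters the maximum as `0ℚ`, which the set found so far reaches because
      -- prices are nonnegative.
      ...   | false = F , feas , ℚ.≤-trans (ℚ.≤-reflexive eq) (revenue≥0 F)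

-- Switching a set of left vertices from `p` to `q`.

module Switch (I : Instance) (p q : Pricing I) (M N : EdgeSet I)
  (M-feasible : Feasible I (proj₁ p) M) (N-feasible : Feasible I (proj₁ q) N) where
  open Instance I

  private
    -- The summand `0ℚ` stands for the right endpoint and makes every revenue definitionally a `∑ℚ`
    -- of prices.
    price : Pricing I → Fin m → ℚ
    price r e = proj₁ r (left e) ℚ.+ 0ℚ

  0≤price : ∀ r e → 0ℚ ℚ.≤ price r e
  0≤price r e = ℚ.+-mono-≤ (0≤pricing I r (left e)) ℚ.≤-refl

  -- A pair (e , f) means that inserting e ∈ N may cost f ∈ M at their common right endpoint.
  pairs : List (Fin m × Fin m)
  pairs = matching right (edges I N) (edges I M)

  -- Switching the tail may evict an edge of `M` at the head. Loops are allowed and never lie in a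
  -- cut: switching a vertex drops its own edges of `M` anyway.
  tail head : Fin m × Fin m → Fin nL
  tail = left ∘ proj₁
  head = left ∘ proj₂

  weight : Fin m × Fin m → ℚ
  weight = price p ∘ proj₂

  0≤weight : ∀ α → 0ℚ ℚ.≤ weight α
  0≤weight = 0≤price p ∘ proj₂

  gain : Fin nL → ℚ
  gain u = ∑ℚ (edges I M) (λ f → whenℚ (left f == u) (price p f))
    ℚ.+ ∑ℚ (edges I N) (λ e → whenℚ (left e == u) (ℚ.- price q e))

  open Walks pairs tail head
  open Averaging gain weight 0≤weight

  atL : Fin nL → Fin m → ℕ
  atL u e = whenℕ (left e == u) 1

  degL-∑ : ∀ F u → degL I F u ≡ ∑ℕ (edges I F) (atL u)
  degL-∑ F u = length-filter-∑ (λ e → left e ≟F u) (edges I F)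

  -- An edge of `N` occurs in at most one pair, so the capacity at `u` will bound the outdegree.
  outDegree≤ : ∀ u → outDegree u ℕ.≤ degL I N u
  outDegree≤ u = subst (outDegree u ℕ.≤_) (sym (degL-∑ N u))
    (Sℕ.∑-matching₁ right (edges I N) (edges I M) (λ _ → z≤n))

  inDegree≤ : ∀ v → inDegree v ℕ.≤ degL I M v
  inDegree≤ v = subst (inDegree v ℕ.≤_) (sym (degL-∑ M v))
    (Sℕ.∑-matching₂ right (edges I N) (edges I M) (λ _ → z≤n))

  module _ (S : Fin nL → Bool) where

    switched : Pricing I
    switched = (λ u → if S u then proj₁ q u else proj₁ p u) , ok
      where
      ok : IsPricing I (λ u → if S u then proj₁ q u else proj₁ p u)
      ok u with S u
      ... | true  = proj₂ q u
      ... | false = proj₂ p u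

    -- Only an inequality, since `p` and `q` may agree at some vertices of `S`.
    HW-switched : HW I (proj₁ p) (proj₁ switched) ℕ.≤ ∑ℕ (allFin nL) (λ u → whenℕ (S u) 1)
    HW-switched = begin
      HW I (proj₁ p) (proj₁ switched)
        ≡⟨ length-filter-∑ differs? (allFin nL) ⟩
      ∑ℕ (allFin nL) (λ u → whenℕ (does (differs? u)) 1)
        ≤⟨ Sℕ.∑-mono (allFin nL) only-S ⟩
      ∑ℕ (allFin nL) (λ u → whenℕ (S u) 1) ∎
      where
      open ℕ.≤-Reasoning
      differs? : ∀ u → Dec (proj₁ p u ≢ proj₁ switched u)
      differs? u = ¬? (proj₁ p u ℚ.≟ proj₁ switched u)
      only-S : ∀ u → whenℕ (does (differs? u)) 1 ℕ.≤ whenℕ (S u) 1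
      only-S u with S u
      ... | true  = Sℕ.when≤ (does (¬? (proj₁ p u ℚ.≟ proj₁ q u))) z≤n
      ... | false with proj₁ p u ℚ.≟ proj₁ p u
      ...   | yes _ = z≤n
      ...   | no ≢  = contradiction refl ≢

    removedBy : Fin m → Fin m × Fin m → Bool
    removedBy f (e , f′) = S (left e) ∧ (f′ == f)

    inS removed kept : Fin m → Bool
    inS e     = S (left e)
    removed f = any (removedBy f) pairs
    kept f    = not (inS f) ∧ not (removed f)

    switchedEdges : EdgeSet I
    switchedEdges = splice inS removed N M

    -- Nothing is mixed at a left vertex: all its edges come from `N` if it is switched, and all
    -- from `M` otherwise.
    degL-switched : ∀ u → capOK (degL I switchedEdges u) (μL u) ≡ true
    degL-switched u with S u in Su
    ... | true  = capOK-mono (μL u) le (proj₁ (proj₂ N-feasible) u)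
      where
      none : ∀ f → whenℕ (kept f) (atL u f) ≡ 0
      none f with left f == u in eq
      ... | false = Sℕ.when-0 (kept f)
      ... | true rewrite ==⇒≡ (left f) u eq | Su = refl
      le : degL I switchedEdges u ℕ.≤ degL I N u
      le = begin
        degL I switchedEdges u
          ≡⟨ trans (degL-∑ switchedEdges u) (Sℕ.∑-splice I inS removed N M (atL u)) ⟩
        ∑ℕ (edges I N) (λ e → whenℕ (inS e) (atL u e)) ℕ.+ ∑ℕ (edges I M) (λ f → whenℕ (kept f) (atL u f))
          ≤⟨ ℕ.+-mono-≤ (Sℕ.∑-mono (edges I N) (λ e → Sℕ.when≤ (inS e) z≤n))
               (ℕ.≤-reflexive (trans (Sℕ.∑-cong (edges I M) none) (Sℕ.∑-0 (edges I M)))) ⟩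
        ∑ℕ (edges I N) (atL u) ℕ.+ 0
          ≡⟨ trans (ℕ.+-identityʳ _) (sym (degL-∑ N u)) ⟩
        degL I N u ∎
        where open ℕ.≤-Reasoning
    ... | false = capOK-mono (μL u) le (proj₁ (proj₂ M-feasible) u)
      where
      none : ∀ e → whenℕ (inS e) (atL u e) ≡ 0
      none e with left e == u in eq
      ... | false = Sℕ.when-0 (inS e)
      ... | true rewrite ==⇒≡ (left e) u eq | Su = refl
      le : degL I switchedEdges u ℕ.≤ degL I M u
      le = begin
        degL I switchedEdges u
          ≡⟨ trans (degL-∑ switchedEdges u) (Sℕ.∑-splice I inS removed N M (atL u)) ⟩
        ∑ℕ (edges I N) (λ e → whenℕ (inS e) (atL u e)) ℕ.+ ∑ℕ (edges I M) (λ f → whenℕ (kept f) (atL u f))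
          ≤⟨ ℕ.+-mono-≤ (ℕ.≤-reflexive (trans (Sℕ.∑-cong (edges I N) none) (Sℕ.∑-0 (edges I N))))
               (Sℕ.∑-mono (edges I M) (λ f → Sℕ.when≤ (kept f) z≤n)) ⟩
        ∑ℕ (edges I M) (atL u)
          ≡⟨ degL-∑ M u ⟨
        degL I M u ∎
        where open ℕ.≤-Reasoning

    -- At a right vertex, inserting an edge of `N` evicts its partner, so a pair never survives as a
    -- whole. The degree is thus at most the larger of the two old degrees, both of which respect
    -- the capacity.
    degR-switched : ∀ v → capOK (degR I switchedEdges v) (μR v) ≡ true
    degR-switched v = capOK-mono (μR v) le (capOK-⊔ (μR v) (proj₂ (proj₂ N-feasible) v) (proj₂ (proj₂ M-feasible) v))
      where
      open ℕ.≤-Reasoning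
      at : Fin m → ℕ
      at e = whenℕ (right e == v) 1
      to-fibre : ∀ F (b : Fin m → Bool) →
        ∑ℕ (edges I F) (λ e → whenℕ (b e) (at e)) ≡ ∑ℕ (fibre right v (edges I F)) (λ e → whenℕ (b e) 1)
      to-fibre F b = trans (Sℕ.∑-cong (edges I F) (λ e → Sℕ.when-comm (b e) (right e == v) 1))
        (sym (Sℕ.∑-filter (λ e → right e ≟F v) (edges I F) _))
      exclusive : ∀ {e f} → (e , f) ∈ zip (fibre right v (edges I N)) (fibre right v (edges I M)) →
        inS e ≡ true → kept f ≡ false
      exclusive {e} {f} ef∈ e∈S
        rewrite any⁺ (removedBy f)
          (∈-concatMap⁺ (λ v → zip (fibre right v (edges I N)) (fibre right v (edges I M))) (lose (∈-allFin v) ef∈))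
          (cong₂ _∧_ e∈S (==-refl f)) with inS f
      ... | true  = refl
      ... | false = refl
      le : degR I switchedEdges v ℕ.≤ degR I N v ℕ.⊔ degR I M v
      le = begin
        degR I switchedEdges v
          ≡⟨ trans (length-filter-∑ (λ e → right e ≟F v) (edges I switchedEdges)) (Sℕ.∑-splice I inS removed N M at) ⟩
        ∑ℕ (edges I N) (λ e → whenℕ (inS e) (at e)) ℕ.+ ∑ℕ (edges I M) (λ f → whenℕ (kept f) (at f))
          ≡⟨ cong₂ ℕ._+_ (to-fibre N inS) (to-fibre M kept) ⟩
        ∑ℕ (fibre right v (edges I N)) (λ e → whenℕ (inS e) 1) ℕ.+ ∑ℕ (fibre right v (edges I M)) (λ f → whenℕ (kept f) 1)
          ≤⟨ ∑-zip-exclusive (fibre right v (edges I N)) (fibre right v (edges I M)) inS kept exclusive ⟩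
        degR I N v ℕ.⊔ degR I M v ∎

    switched-feasible : Feasible I (proj₁ switched) switchedEdges
    switched-feasible = prices , degL-switched , degR-switched
      where
      prices : ∀ e → lookup switchedEdges e ≡ true → proj₁ switched (left e) ℚ.≤ budget e
      prices e e∈ with S (left e) | trans (sym (lookup∘tabulate (λ e → if inS e then lookup N e else lookup M e ∧ not (removed e)) e)) e∈
      ... | true  | e∈N = proj₁ N-feasible e e∈N
      ... | false | e∈M = proj₁ M-feasible e (proj₁ (∧-true⁻ e∈M))

    gainedN keptM leftM boundary : ℚ
    gainedN  = ∑ℚ (edges I N) (λ e → whenℚ (inS e) (price q e))
    keptM    = ∑ℚ (edges I M) (λ f → whenℚ (kept f) (price p f))
    leftM    = ∑ℚ (edges I M) (λ f → whenℚ (inS f) (price p f))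
    boundary = ∑ℚ pairs (λ α → whenℚ (S (tail α) ∧ not (S (head α))) (weight α))

    -- Inserted edges start in `S` and are sold at the prices of `q`; kept edges start outside `S`
    -- and are sold at those of `p`.
    revenue-switched : revenue I (proj₁ switched) switchedEdges ≡ gainedN ℚ.+ keptM
    revenue-switched = trans (Sℚ.∑-splice I inS removed N M (price switched))
      (cong₂ ℚ._+_ (Sℚ.∑-cong (edges I N) onN) (Sℚ.∑-cong (edges I M) onM))
      where
      onN : ∀ e → whenℚ (inS e) (price switched e) ≡ whenℚ (inS e) (price q e)
      onN e with S (left e)
      ... | true  = refl
      ... | false = refl
      onM : ∀ f → whenℚ (kept f) (price switched f) ≡ whenℚ (kept f) (price p f)
      onM f with S (left f)
      ... | true  = refl
      ... | false = refl

    lostM : ℚ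
    lostM = ∑ℚ (edges I M) (λ f → whenℚ (not (inS f)) (whenℚ (removed f) (price p f)))

    -- An evicted edge outside `S` is the partner of an edge inserted at `S`. Charging it to all
    -- such pairs and exchanging the sums turns the loss into the weight of arcs leaving `S`.
    lostM≤boundary : lostM ℚ.≤ boundary
    lostM≤boundary = begin
      lostM
        ≤⟨ Sℚ.∑-mono (edges I M) (λ f → Sℚ.when-mono (not (inS f)) (Sℚ.when-any≤ (removedBy f) pairs (0≤price p f))) ⟩
      ∑ℚ (edges I M) (λ f → whenℚ (not (inS f)) (∑ℚ pairs (λ α → whenℚ (removedBy f α) (price p f))))
        ≡⟨ Sℚ.∑-edges I M _ ⟩
      ∑ℚ (allFin m) (λ f → whenℚ (lookup M f) (whenℚ (not (inS f)) (∑ℚ pairs (λ α → whenℚ (removedBy f α) (price p f)))))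
        -- All terms are nonnegative, so the sum may be extended from `M` to all edges, where
        -- `∑-pick` can evaluate it.
        ≤⟨ Sℚ.∑-mono (allFin m) (λ f → Sℚ.when≤ (lookup M f)
             (Sℚ.0≤when (not (inS f)) (Sℚ.0≤∑ pairs (λ α → Sℚ.0≤when (removedBy f α) (0≤price p f))))) ⟩
      ∑ℚ (allFin m) (λ f → whenℚ (not (inS f)) (∑ℚ pairs (λ α → whenℚ (removedBy f α) (price p f))))
        ≡⟨ Sℚ.∑-cong (allFin m) (λ f → trans (sym (Sℚ.∑-when pairs (not (inS f)) (λ α → whenℚ (removedBy f α) (price p f))))
             (Sℚ.∑-cong pairs (λ α → reorder (not (inS f)) (S (tail α)) (proj₂ α == f) (price p f)))) ⟩
      ∑ℚ (allFin m) (λ f → ∑ℚ pairs (λ α → whenℚ (proj₂ α == f) (whenℚ (S (tail α) ∧ not (inS f)) (price p f))))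
        ≡⟨ Sℚ.∑-swap (allFin m) pairs (λ f α → whenℚ (proj₂ α == f) (whenℚ (S (tail α) ∧ not (inS f)) (price p f))) ⟩
      ∑ℚ pairs (λ α → ∑ℚ (allFin m) (λ f → whenℚ (proj₂ α == f) (whenℚ (S (tail α) ∧ not (inS f)) (price p f))))
        ≡⟨ Sℚ.∑-cong pairs (λ α → Sℚ.∑-pick (proj₂ α) (λ f → whenℚ (S (tail α) ∧ not (inS f)) (price p f))) ⟩
      boundary ∎
      where
      open ℚ.≤-Reasoning
      reorder : ∀ a b c x → whenℚ a (whenℚ (b ∧ c) x) ≡ whenℚ c (whenℚ (b ∧ a) x)
      reorder true  true  c x = refl
      reorder true  false c x = sym (Sℚ.when-0 c)
      reorder false true  c x = sym (Sℚ.when-0 c)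
      reorder false false c x = sym (Sℚ.when-0 c)

    -- The parts are the edges at `S`, the kept ones, and those outside `S` that a partner evicts.
    revenue-split : revenue I (proj₁ p) M ≡ (leftM ℚ.+ keptM) ℚ.+ lostM
    revenue-split = trans (Sℚ.∑-cong (edges I M) (λ f → split (inS f) (removed f) (price p f)))
      (trans (Sℚ.∑-+ (edges I M) (λ f → whenℚ (inS f) (price p f) ℚ.+ whenℚ (kept f) (price p f))
                (λ f → whenℚ (not (inS f)) (whenℚ (removed f) (price p f))))
             (cong (ℚ._+ lostM) (Sℚ.∑-+ (edges I M) (λ f → whenℚ (inS f) (price p f)) (λ f → whenℚ (kept f) (price p f)))))
      where
      open +-*-Solver
      split : ∀ s r x → x ≡ (whenℚ s x ℚ.+ whenℚ (not s ∧ not r) x) ℚ.+ whenℚ (not s) (whenℚ r x)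
      split true  r     x = solve 1 (λ x → x := (x :+ con 0ℚ) :+ con 0ℚ) refl x
      split false true  x = solve 1 (λ x → x := (con 0ℚ :+ con 0ℚ) :+ x) refl x
      split false false x = solve 1 (λ x → x := (con 0ℚ :+ x) :+ con 0ℚ) refl x

    gain-S : ∑ℚ (allFin nL) (λ v → whenℚ (S v) (gain v)) ≡ leftM ℚ.+ ℚ.- gainedN
    gain-S = trans
      (trans (Sℚ.∑-cong (allFin nL) (λ v → Sℚ.when-+ (S v) (atM v) (atN v)))
             (Sℚ.∑-+ (allFin nL) (λ v → whenℚ (S v) (atM v)) (λ v → whenℚ (S v) (atN v))))
      (cong₂ ℚ._+_ (Sℚ.∑-fibre-when (edges I M) left S (price p))
        (trans (Sℚ.∑-fibre-when (edges I N) left S (λ e → ℚ.- price q e))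
          (trans (Sℚ.∑-cong (edges I N) (λ e → when-neg (inS e) (price q e)))
                 (∑-neg (edges I N) (λ e → whenℚ (inS e) (price q e))))))
      where
      atM atN : Fin nL → ℚ
      atM v = ∑ℚ (edges I M) (λ f → whenℚ (left f == v) (price p f))
      atN v = ∑ℚ (edges I N) (λ e → whenℚ (left e == v) (ℚ.- price q e))

    -- Compare `switchedEdges` with `M`: the kept edges earn the same on both sides and cancel, and
    -- the evicted ones cost at most the boundary.
    cut : val I (proj₁ switched) ℚ.≤ revenue I (proj₁ p) M → Cut≥0 S
    cut no-gain = subst (λ x → 0ℚ ℚ.≤ x ℚ.+ boundary) (sym gain-S) (begin
      0ℚ
        ≡⟨ ℚ.+-inverseʳ (gainedN ℚ.+ keptM) ⟨
      (gainedN ℚ.+ keptM) ℚ.+ ℚ.- (gainedN ℚ.+ keptM)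
        ≤⟨ ℚ.+-mono-≤ revenue≤ (ℚ.≤-refl {ℚ.- (gainedN ℚ.+ keptM)}) ⟩
      ((leftM ℚ.+ keptM) ℚ.+ boundary) ℚ.+ ℚ.- (gainedN ℚ.+ keptM)
        ≡⟨ solve 4 (λ x k y b → ((y :+ k) :+ b) :+ :- (x :+ k) := (y :+ :- x) :+ b) refl gainedN keptM leftM boundary ⟩
      (leftM ℚ.+ ℚ.- gainedN) ℚ.+ boundary ∎)
      where
      open ℚ.≤-Reasoning
      open +-*-Solver
      revenue≤ : gainedN ℚ.+ keptM ℚ.≤ (leftM ℚ.+ keptM) ℚ.+ boundary
      revenue≤ = begin
        gainedN ℚ.+ keptM                               ≡⟨ revenue-switched ⟨
        revenue I (proj₁ switched) switchedEdges        ≤⟨ revenue≤val I (proj₁ switched) switchedEdges switched-feasible ⟩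
        val I (proj₁ switched)                          ≤⟨ no-gain ⟩
        revenue I (proj₁ p) M                           ≡⟨ revenue-split ⟩
        (leftM ℚ.+ keptM) ℚ.+ lostM                     ≤⟨ ℚ.+-monoʳ-≤ (leftM ℚ.+ keptM) lostM≤boundary ⟩
        (leftM ℚ.+ keptM) ℚ.+ boundary                  ∎

  gain-total : ∑ℚ (allFin nL) gain ≡ revenue I (proj₁ p) M ℚ.+ ℚ.- revenue I (proj₁ q) N
  gain-total = trans (Sℚ.∑-+ (allFin nL) (λ v → ∑ℚ (edges I M) (λ f → whenℚ (left f == v) (price p f)))
                                        (λ v → ∑ℚ (edges I N) (λ e → whenℚ (left e == v) (ℚ.- price q e))))
    (cong₂ ℚ._+_ (Sℚ.∑-fibre (edges I M) left (price p))
      (trans (Sℚ.∑-fibre (edges I N) left (λ e → ℚ.- price q e)) (∑-neg (edges I N) (price q))))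

  revenue-bound : ∀ {C d} → (∀ u → CapLe (μL u) C) → LocallyOptimal I (geomSum C d) p →
    val I (proj₁ p) ℚ.≤ revenue I (proj₁ p) M →
    geomSum C d · revenue I (proj₁ q) N ℚ.≤ (geomSum C d ℕ.+ C ^ d) · revenue I (proj₁ p) M
  revenue-bound {C} {d} μ≤C p-local attained = begin
    ρ ℚ.* rN
      -- The inequality from `averaging` is added to `ρ ℚ.* rN`, which cancels the negative part of
      -- the total gain.
      ≡⟨ solve 2 (λ ρ n → ρ :* n := con 0ℚ :+ ρ :* n) refl ρ rN ⟩
    0ℚ ℚ.+ ρ ℚ.* rN
      ≤⟨ ℚ.+-mono-≤ (averaging {C} {d}
           (λ u → ℕ.≤-trans (outDegree≤ u) (capOK-CapLe (μL u) (μ≤C u) (proj₁ (proj₂ N-feasible) u)))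
           (λ v → ℕ.≤-trans (inDegree≤ v) (capOK-CapLe (μL v) (μ≤C v) (proj₁ (proj₂ M-feasible) v)))
           (λ S small → cut S (ℚ.≤-trans (p-local (switched S) (ℕ.≤-trans (HW-switched S) small)) attained)))
         (ℚ.≤-refl {ρ ℚ.* rN}) ⟩
    (ρ ℚ.* ∑ℚ (allFin nL) gain ℚ.+ κ ℚ.* ∑ℚ pairs weight) ℚ.+ ρ ℚ.* rN
      -- Each edge of `M` is a partner at most once, so all arcs together weigh no more than `rM`.
      ≤⟨ ℚ.+-mono-≤ (ℚ.+-monoʳ-≤ (ρ ℚ.* ∑ℚ (allFin nL) gain)
           (·-monoʳ (C ^ d) (Sℚ.∑-matching₂ right (edges I N) (edges I M) (0≤price p)))) (ℚ.≤-refl {ρ ℚ.* rN}) ⟩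
    (ρ ℚ.* ∑ℚ (allFin nL) gain ℚ.+ κ ℚ.* rM) ℚ.+ ρ ℚ.* rN
      ≡⟨ cong (λ g → (ρ ℚ.* g ℚ.+ κ ℚ.* rM) ℚ.+ ρ ℚ.* rN) gain-total ⟩
    (ρ ℚ.* (rM ℚ.+ ℚ.- rN) ℚ.+ κ ℚ.* rM) ℚ.+ ρ ℚ.* rN
      ≡⟨ solve 4 (λ ρ κ x y → (ρ :* (x :+ :- y) :+ κ :* x) :+ ρ :* y := ρ :* x :+ κ :* x) refl ρ κ rM rN ⟩
    ρ ℚ.* rM ℚ.+ κ ℚ.* rM
      ≡⟨ ·-+ (geomSum C d) (C ^ d) rM ⟨
    (geomSum C d ℕ.+ C ^ d) · rM ∎
    where
    open ℚ.≤-Reasoning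
    open +-*-Solver
    ρ κ rM rN : ℚ
    ρ  = ℕtoℚ (geomSum C d)
    κ  = ℕtoℚ (C ^ d)
    rM = revenue I (proj₁ p) M
    rN = revenue I (proj₁ q) N

-- Closed forms of the constants and the final ratio.

geomSum-closed : ∀ c k → c ℕ.* geomSum (suc c) k ℕ.+ 1 ≡ suc c ^ suc k
geomSum-closed c zero    = base c
  where
  base : ∀ c → c ℕ.* 1 ℕ.+ 1 ≡ suc c ℕ.* 1
  base = solve-∀
geomSum-closed c (suc k) = begin
  c ℕ.* (geomSum (suc c) k ℕ.+ X) ℕ.+ 1         ≡⟨ expand c (geomSum (suc c) k) X ⟩
  (c ℕ.* geomSum (suc c) k ℕ.+ 1) ℕ.+ c ℕ.* X   ≡⟨ cong (ℕ._+ c ℕ.* X) (geomSum-closed c k) ⟩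
  X ℕ.+ c ℕ.* X                                 ∎
  where
  open ≡-Reasoning
  X : ℕ
  X = suc c ^ suc k
  expand : ∀ c g x → c ℕ.* (g ℕ.+ x) ℕ.+ 1 ≡ (c ℕ.* g ℕ.+ 1) ℕ.+ c ℕ.* x
  expand = solve-∀

numerator : ∀ c d → suc c ^ (d ℕ.+ 1) ∸ 1 ≡ c ℕ.* geomSum (suc c) d
numerator c d = begin
  suc c ^ (d ℕ.+ 1) ∸ 1                  ≡⟨ cong (λ k → suc c ^ k ∸ 1) (ℕ.+-comm d 1) ⟩
  suc c ^ suc d ∸ 1                      ≡⟨ cong (_∸ 1) (geomSum-closed c d) ⟨
  c ℕ.* geomSum (suc c) d ℕ.+ 1 ∸ 1      ≡⟨ ℕ.m+n∸n≡m (c ℕ.* geomSum (suc c) d) 1 ⟩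
  c ℕ.* geomSum (suc c) d                ∎
  where open ≡-Reasoning

denominator : ∀ c d → 2 ℕ.* suc c ^ (d ℕ.+ 1) ∸ suc c ^ d ∸ 1 ≡ c ℕ.* (geomSum (suc c) d ℕ.+ suc c ^ d)
denominator c d = begin
  2 ℕ.* suc c ^ (d ℕ.+ 1) ∸ Y ∸ 1                  ≡⟨ cong (λ k → 2 ℕ.* suc c ^ k ∸ Y ∸ 1) (ℕ.+-comm d 1) ⟩
  2 ℕ.* suc c ^ suc d ∸ Y ∸ 1                      ≡⟨ ℕ.∸-+-assoc (2 ℕ.* suc c ^ suc d) Y 1 ⟩
  2 ℕ.* suc c ^ suc d ∸ (Y ℕ.+ 1)                  ≡⟨ cong (_∸ (Y ℕ.+ 1)) double ⟩
  c ℕ.* (G ℕ.+ Y) ℕ.+ (Y ℕ.+ 1) ∸ (Y ℕ.+ 1)        ≡⟨ ℕ.m+n∸n≡m (c ℕ.* (G ℕ.+ Y)) (Y ℕ.+ 1) ⟩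
  c ℕ.* (G ℕ.+ Y)                                  ∎
  where
  open ≡-Reasoning
  G Y : ℕ
  G = geomSum (suc c) d
  Y = suc c ^ d
  collect : ∀ c g y → (c ℕ.* g ℕ.+ 1) ℕ.+ (suc c ℕ.* y) ≡ c ℕ.* (g ℕ.+ y) ℕ.+ (y ℕ.+ 1)
  collect = solve-∀
  -- The two truncated subtractions have been merged into one; writing the minuend as a sum ending
  -- in `Y + 1` makes that one exact.
  double : 2 ℕ.* suc c ^ suc d ≡ c ℕ.* (G ℕ.+ Y) ℕ.+ (Y ℕ.+ 1)
  double = trans (cong (suc c ^ suc d ℕ.+_) (ℕ.+-identityʳ (suc c ^ suc d)))
    (trans (cong (ℕ._+ suc c ^ suc d) (sym (geomSum-closed c d))) (collect c G Y))

theorem10 : (C d : ℕ) → 2 ≤ C → 1 ≤ d → (I : Instance)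
    → ((u : Fin (Instance.nL I)) → CapLe (Instance.μL I u) C)
    → (pstar p : Pricing I)
    → Optimal I pstar
    → LocallyOptimal I (geomSum C d) p
    → (ℕtoℚ (C ^ (d Data.Nat.+ 1) ∸ 1) *ℚ val I (proj₁ pstar))
    ≤ℚ (ℕtoℚ (2 * C ^ (d Data.Nat.+ 1) ∸ C ^ d ∸ 1) *ℚ val I (proj₁ p))
-- Scaled by C^d, the claimed fraction is `num` over `den`. With `C` split as `suc c`, their common
-- factor C - 1 is `c`, and what remains is `ρ` over `ρ + κ`.
theorem10 (suc c) d _ _ I μ≤C q p _ p-local =
  let M , M-feasible , p≤M = val-attained I (proj₁ p) (0≤pricing I p)
      N , N-feasible , q≤N = val-attained I (proj₁ q) (0≤pricing I q)
      rM = revenue I (proj₁ p) M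
      rN = revenue I (proj₁ q) N
  in begin
  num · val I (proj₁ q)
    ≤⟨ ·-monoʳ num q≤N ⟩
  num · rN
    ≡⟨ trans (cong (_· rN) (numerator c d)) (·-· c ρ rN) ⟩
  c · (ρ · rN)
    ≤⟨ ·-monoʳ c (Switch.revenue-bound I p q M N M-feasible N-feasible {suc c} {d} μ≤C p-local p≤M) ⟩
  c · ((ρ ℕ.+ κ) · rM)
    ≡⟨ trans (cong (_· rM) (denominator c d)) (·-· c (ρ ℕ.+ κ) rM) ⟨
  den · rM
    ≤⟨ ·-monoʳ den (revenue≤val I (proj₁ p) M M-feasible) ⟩
  den · val I (proj₁ p) ∎
  where
  open ℚ.≤-Reasoning
  ρ κ num den : ℕ
  ρ   = geomSum (suc c) d
  κ   = suc c ^ d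
  num = suc c ^ (d ℕ.+ 1) ∸ 1
  den = 2 ℕ.* suc c ^ (d ℕ.+ 1) ∸ suc c ^ d ∸ 1
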